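{- Let $p$ be a prime and let $q$ be an odd prime with $q \neq p$. Define $\delta = \operatorname{ord}_q(p)$ and $\mu = v_q(p^\delta - 1)$ (so $\mu \geq 1$). Let $\phi(z) = z^q$, and let $T_q(z)$ be the $q$-th Chebyshev polynomial. Then for every integer $\nu \geq 0$: $$\lim_{\substack{n \to \infty\\ \delta \mid n\\ v_q(n)=\nu}}\frac{\#\operatorname{Per}\left(\phi, \mathbb{F}_{p^n}\right)}{p^n} = \frac{1}{q^{\mu+\nu}},$$ and $$\lim_{\substack{n \to \infty\\ \delta \mid 2n\\ v_q(n)=\nu}}\frac{\#\operatorname{Per}\left(T_q, \mathbb{F}_{p^n}\right)}{p^n} = \frac{q^{\mu+\nu}+1}{2 q^{\mu+\nu}}.$$
   Context: For a polynomial $\phi$ with coefficients in $\mathbb{Z}$ (reduced mod $p$ when acting on fields of characteristic $p$) and a field $K$, $\operatorname{Per}(\phi,K)=\{\alpha\in K : \phi^m(\alpha)=\alpha \text{ for some } m>0\}$, where $\phi^m$ is the $m$-th iterate of $\phi$ under composition. $\mathbb{F}_{p^n}$ is the field with $p^n$ elements. $v_q(n)$ is the $q$-adic valuation of $n$. $\operatorname{ord}_q(p)$ is the multiplicative order of $p$ modulo $q$, i.e. the smallest positive integer $\delta$ with $q \mid p^\delta-1$. The Chebyshev polynomials $T_d\in\mathbb{Z}[w]$ are defined by $T_0(w)=2$, $T_1(w)=w$, $T_d(w)=wT_{d-1}(w)-T_{d-2}(w)$ for $d\ge 2$; equivalently $T_d$ is the polynomial satisfying $T_d(z+z^{ -1})=z^d+z^{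 -d}$. The limits are taken as $n\to\infty$ through the positive integers $n$ satisfying the conditions displayed under the limit sign. -}

module Defs where

open import Level using (_⊔_) renaming (suc to lsuc)
open import Data.Nat.Base as ℕ using (ℕ; zero; suc; _^_; NonZero)
import Data.Nat.Properties as ℕ
open import Data.Nat.Divisibility using (_∣_; _∤_)
open import Data.Nat.Primality using (Prime; prime⇒nonZero)
open import Data.Integer.Base as ℤ using (ℤ; +_; -[1+_]; 0ℤ; 1ℤ)
open import Data.Rational.Base as ℚ using (ℚ; 0ℚ)
open import Data.Fin.Base as Fin using (Fin; toℕ; fromℕ<)
import Data.Fin.Properties as Fin
open import Data.List.Base using (List; []; _∷_; map; filter; length; allFin)
open import Data.Product.Base using (∃; ∃-syntax; _×_; _,_)
open import Function.Bundles using (Inverse; Injection)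
open import Function.Properties.Inverse using (Inverse⇒Injection)
import Function.Endo.Propositional as Endo
open import Algebra.Apartness.Bundles using (HeytingField; HeytingCommutativeRing)
open import Algebra.Bundles using (CommutativeRing)
import Algebra.Properties.Semiring.Mult as Mult
open import Relation.Binary.Definitions using (Decidable)
open import Relation.Binary.PropositionalEquality as ≡ using (_≡_)
open import Relation.Nullary.Decidable using (map′; via-injection)
open import Relation.Unary using () renaming (Decidable to Decidable₁)

prime^≢0 : ∀ {p} → Prime p → ∀ n → NonZero (p ^ n)
prime^≢0 {p} pp n = ℕ.m^n≢0 p n {{prime⇒nonZero pp}}

-- The order δ of p modulo q; the truncated subtraction is exact for p ≥ 1.
record IsMultOrder (q p δ : ℕ) : Set where
  field
    positive : 0 ℕ.< δ
    divides  : q ∣ p ^ δ ℕ.∸ 1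
    minimal  : ∀ {e} → 0 ℕ.< e → q ∣ p ^ e ℕ.∸ 1 → δ ℕ.≤ e

-- v_q(n) = k; no k qualifies when n = 0.
IsValuation : (q n k : ℕ) → Set
IsValuation q n k = q ^ k ∣ n × q ^ suc k ∤ n

-- Integer polynomials: the list a₀ ∷ a₁ ∷ … ∷ aₙ ∷ [] is a₀ + a₁z + … + aₙzⁿ.
-- Trailing zeros are allowed.
Poly : Set
Poly = List ℤ

infixl 6 _−ₚ_
_−ₚ_ : Poly → Poly → Poly
[]       −ₚ bs       = map ℤ.-_ bs
as       −ₚ []       = as
(a ∷ as) −ₚ (b ∷ bs) = (a ℤ.- b) ∷ (as −ₚ bs)

var·_ : Poly → Poly
var· as = 0ℤ ∷ as

power : ℕ → Poly
power zero    = 1ℤ ∷ []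
power (suc d) = var· power d

chebyshev : ℕ → Poly
chebyshev 0             = + 2 ∷ []
chebyshev 1             = var· (1ℤ ∷ [])
chebyshev (suc (suc d)) = var· chebyshev (suc d) −ₚ chebyshev d

module Evaluation {c ℓ} (R : CommutativeRing c ℓ) where
  open CommutativeRing R
  open Mult semiring using () renaming (_×_ to _×ᴿ_)

  fromℤ : ℤ → Carrier
  fromℤ (+ n)    = n ×ᴿ 1#
  fromℤ -[1+ n ] = - (suc n ×ᴿ 1#)

  eval : Poly → Carrier → Carrier
  eval []       x = 0#
  eval (a ∷ as) x = fromℤ a + x * eval as x

  eval-cong : ∀ φ {x y} → x ≈ y → eval φ x ≈ eval φ y
  eval-cong []       x≈y = refl
  eval-cong (a ∷ as) x≈y = +-congˡ (*-cong x≈y (eval-cong as x≈y))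

-- A finite type in bijection with Fin k has decidable equality, so a Heyting
-- field structure on it is a field in the usual sense: x # y holds exactly
-- when x ≉ y.
record FiniteField c ℓ₁ ℓ₂ (k : ℕ) : Set (lsuc (c ⊔ ℓ₁ ⊔ ℓ₂)) where
  field
    heytingField : HeytingField c ℓ₁ ℓ₂

  open HeytingField heytingField using (heytingCommutativeRing)

  commutativeRing : CommutativeRing c ℓ₁
  commutativeRing = HeytingCommutativeRing.commutativeRing heytingCommutativeRing

  open CommutativeRing commutativeRing using (setoid)

  field
    enumeration : Inverse setoid (≡.setoid (Fin k))

module Periodic {c ℓ₁ ℓ₂ k} (K : FiniteField c ℓ₁ ℓ₂ k) (φ : Poly) where
  open FiniteField K
  open CommutativeRing commutativeRing
    using (Carrier; _≈_; setoid; refl; sym; trans; reflexive)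
  open Evaluation commutativeRing
  open Endo Carrier using () renaming (_^_ to _^∘_)
  open Inverse enumeration using (to; from)

  Per : Carrier → Set ℓ₁
  Per α = ∃[ m ] 0 ℕ.< m × (eval φ ^∘ m) α ≈ α

  private
    f = eval φ

    iter-cong : ∀ m {x y} → x ≈ y → (f ^∘ m) x ≈ (f ^∘ m) y
    iter-cong zero    x≈y = x≈y
    iter-cong (suc m) x≈y = eval-cong φ (iter-cong m x≈y)

    iter-+ : ∀ m n x → (f ^∘ (m ℕ.+ n)) x ≡ (f ^∘ m) ((f ^∘ n) x)
    iter-+ zero    n x = ≡.refl
    iter-+ (suc m) n x = ≡.cong f (iter-+ m n x)

    iter-* : ∀ i m {x} → (f ^∘ m) x ≈ x → (f ^∘ (i ℕ.* m)) x ≈ x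
    iter-* zero    m     eq = refl
    iter-* (suc i) m {x} eq = trans (reflexive (iter-+ m (i ℕ.* m) x))
      (trans (iter-cong m (iter-* i m eq)) eq)

    _≈?_ : Decidable _≈_
    _≈?_ = via-injection (Inverse⇒Injection enumeration) Fin._≟_

    Bounded : Carrier → Set ℓ₁
    Bounded α = ∃ λ (i : Fin k) → (f ^∘ suc (toℕ i)) α ≈ α

    -- By the pigeonhole principle a period can be taken to be at most k.
    bounded : ∀ {α} → Per α → Bounded α
    bounded {α} (m , 0<m , eq)
      with i , j , i<j , same ← Fin.pigeonhole (ℕ.n<1+n k) (λ (i : Fin (suc k)) → to ((f ^∘ toℕ i) α))
      = fromℕ< e<k , ≡.subst (λ d → (f ^∘ suc d) α ≈ α) (≡.sym (Fin.toℕ-fromℕ< e<k)) return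
      where
      a = toℕ i
      e = toℕ j ℕ.∸ suc a
      t = a ℕ.* m ℕ.∸ a

      j≡ : suc e ℕ.+ a ≡ toℕ j
      j≡ = ≡.trans (≡.sym (ℕ.+-suc e a)) (ℕ.m∸n+n≡m i<j)

      e<k : e ℕ.< k
      e<k = ℕ.≤-trans (ℕ.≤-trans (ℕ.m≤m+n (suc e) a) (ℕ.≤-reflexive j≡)) (ℕ.s≤s⁻¹ (Fin.toℕ<n j))

      t+a : t ℕ.+ a ≡ a ℕ.* m
      t+a = ℕ.m∸n+n≡m (ℕ.m≤m*n a m {{ℕ.>-nonZero 0<m}})

      meet : (f ^∘ a) α ≈ (f ^∘ toℕ j) α
      meet = Injection.injective (Inverse⇒Injection enumeration) same

      back : (f ^∘ (t ℕ.+ a)) α ≈ α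
      back = trans (reflexive (≡.cong (λ n → (f ^∘ n) α) t+a)) (iter-* a m eq)

      shuffle : suc e ℕ.+ (t ℕ.+ a) ≡ t ℕ.+ toℕ j
      shuffle = ≡.trans (≡.sym (ℕ.+-assoc (suc e) t a))
        (≡.trans (≡.cong (ℕ._+ a) (ℕ.+-comm (suc e) t))
        (≡.trans (ℕ.+-assoc t (suc e) a) (≡.cong (t ℕ.+_) j≡)))

      return : (f ^∘ suc e) α ≈ α
      return =
        trans (iter-cong (suc e) (sym back))
        (trans (reflexive (≡.sym (iter-+ (suc e) (t ℕ.+ a) α)))
        (trans (reflexive (≡.cong (λ n → (f ^∘ n) α) shuffle))
        (trans (reflexive (iter-+ t (toℕ j) α))
        (trans (iter-cong t (sym meet))
        (trans (reflexive (≡.sym (iter-+ t a α))) back)))))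

  per? : Decidable₁ Per
  per? α = map′ (λ (i , eq) → suc (toℕ i) , ℕ.z<s , eq) bounded
    (Fin.any? λ i → (f ^∘ suc (toℕ i)) α ≈? α)

  #Per : ℕ
  #Per = length (filter per? (map from (allFin k)))

-- The limit of a n as n → ∞ through the positive n satisfying P. The first
-- component says that there are arbitrarily large such n, without which the
-- second would hold for every L. For rational a and L, rational ε suffice.
LimitAlong : (P : ℕ → Set) (a : ∀ n → .{{NonZero n}} → ℚ) (L : ℚ) → Set
LimitAlong P a L =
  (∀ N → ∃[ n ] N ℕ.≤ n × NonZero n × P n) ×
  (∀ ε → 0ℚ ℚ.< ε → ∃[ N ] ∀ n .{{_ : NonZero n}} → N ℕ.≤ n → P n →
    ℚ.∣ a n ℚ.- L ∣ ℚ.< ε)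

{-# OPTIONS --safe #-}
module Submission where

-- Let K have Q = pⁿ elements. Frobenius gives T_Q(α) = α for every α in K, so
-- (T_{Q−1}(α) − 2)(T_{Q+1}(α) − 2) = (T_Q(α) − α)² = 0. Hence K = A_{Q−1} ∪ A_{Q+1}, where
-- A_N = {α : T_N(α) = 2}, and the two sets share at most ±2. As T_N − 2 is a square up to a factor
-- of degree at most 2, |A_N| ≤ N/2 + 1, and comparing with |K| = Q shows that both sets have N/2
-- elements up to a bounded error. The odd prime q divides exactly one of Q ± 1, N = q^{μ+ν} M with q ∤ M
-- (lifting the exponent); if N′ is the other one, the periodic points of T_q are A_{N′} ∪ A_M.
-- Finally |A_N| ≤ q^{μ+ν} |A_M|, since T_{q^{μ+ν}} maps A_N to A_M and is a polynomial of degree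
-- q^{μ+ν}. For z^q the same argument applies with x^{Q−1} = 1 and the sets {x : x^N = 1}. All
-- counts are exact up to a constant independent of n, which disappears on dividing by pⁿ.

-- No algebraic closure and no cyclic group structure is used. The element z with α = z + z⁻¹ is
-- adjoined formally, in a free extension of rank two that may have zero divisors; identities are
-- proved there and read off in the first coordinate. They hold over every commutative ring, so
-- characteristic 2, where 2 = -2 = 0, needs no separate treatment. Every cardinality is bounded
-- above only, by counting roots of monic polynomials. Lower bounds come from covers: two sets that
-- cover K and have at most about Q/2 elements each must both have about Q/2. Torsion of order N
-- prime to q is periodic because some q^m is 1 modulo N and T_{Nj+1} fixes A_N pointwise.
-- Conversely, a periodic α is its own image under iterates of arbitrarily large index, which
-- removes the power of q from its order. The condition δ ∣ 2n enters through p^{2n} - 1 = (Q - 1)(Q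
-- + 1). It leaves open which factor q divides, so both cases are carried along.

open import Defs
open import Level using (Level; _⊔_)
import Data.Nat.Base as ℕ
import Data.Nat.Properties as ℕ
open import Data.Nat.Base using (ℕ; zero; suc)
open import Data.Nat.Divisibility using (_∣_; _∤_; _∣0; ∣n⇒∣m*n)
open import Data.Nat.Primality using (Prime; prime⇒nonZero)
import Data.Integer.Base as ℤ
import Data.Integer.Properties as ℤ
open import Data.Fin.Base as Fin using (Fin; toℕ)
import Data.Fin.Properties as Fin
open import Data.List.Base using (List; []; _∷_; filter; length; map; allFin)
open import Data.Product.Base using (map₂; ∃-syntax; _×_; _,_; proj₁; proj₂)
open import Data.Sum.Base as Sum using (_⊎_; inj₁; inj₂; [_,_]′)
open import Function.Base using (_∘_; id)
open import Algebra.Bundles using (CommutativeRing)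
open import Relation.Binary.Definitions using (_Respects_)
open import Relation.Binary.PropositionalEquality as ≡ using (_≡_; _≢_)
open import Relation.Nullary using (¬_; contradiction; Dec; yes; no; ¬?)
open import Relation.Nullary.Decidable using (via-injection; _⊎-dec_)
open import Relation.Unary as Unary using (Pred)

-- Lifting the exponent, and orders modulo a prime.

module Arithmetic where
  open import Data.Nat.Base
  open import Data.Nat.Properties
  open import Data.Nat.Divisibility
  open import Data.Nat.DivMod using (_/_; _%_; _mod_; m≡m%n+[m/n]*n; m%n<n)
  open import Data.Nat.Primality
  open import Data.Nat.Coprimality as Coprimality using (Coprime; coprime-divisor)
  open import Data.Nat.Tactic.RingSolver using (solve; solve-∀)
  open import Data.List.Base using ([]; _∷_)
  open ≡ using (refl; sym; trans; cong; cong₂; subst; module ≡-Reasoning)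

  -- The binomial coefficient C(k, 2), built additively to avoid halving.
  triangular : ℕ → ℕ
  triangular zero    = 0
  triangular (suc k) = k + triangular k

  2*triangular : ∀ k → 2 * triangular (suc k) ≡ suc k * k
  2*triangular zero    = refl
  2*triangular (suc k) = begin
    2 * (suc k + triangular (suc k))   ≡⟨ *-distribˡ-+ 2 (suc k) (triangular (suc k)) ⟩
    2 * suc k + 2 * triangular (suc k) ≡⟨ cong (2 * suc k +_) (2*triangular k) ⟩
    2 * suc k + suc k * k              ≡⟨ solve (k ∷ []) ⟩
    suc (suc k) * suc k                ∎
    where open ≡-Reasoning

  -- The binomial expansion cut off after the quadratic term, in Horner form. For y = q^(j+1) a and
  -- exponent q the remainder y³ r is divisible by q^(j+3), so the terms kept determine the
  -- valuation.
  binomial-mod-cube : ∀ y k → ∃[ r ] (1 + y) ^ k ≡ 1 + y * (k + y * (triangular k + y * r))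
  binomial-mod-cube y zero = 0 , (begin
    1                                ≡⟨ solve (y ∷ []) ⟩
    1 + y * (0 + y * (0 + y * 0))    ∎)
    where open ≡-Reasoning
  binomial-mod-cube y (suc k) with r , eq ← binomial-mod-cube y k =
    triangular k + r + y * r , trans (cong ((1 + y) *_) eq) (expand y k (triangular k) r)
    where
    expand : ∀ y k t r → (1 + y) * (1 + y * (k + y * (t + y * r)))
                       ≡ 1 + y * (suc k + y * (k + t + y * (t + r + y * r)))
    expand = solve-∀

  ∤1+multiple : ∀ {q} → Prime q → ∀ s → q ∤ 1 + q * s
  ∤1+multiple {q} qp s q∣ = contradiction (subst Prime (∣1⇒≡1 q∣1) qp) ¬prime[1]
    where
    q∣1 : q ∣ 1
    q∣1 = ∣m+n∣m⇒∣n (subst (q ∣_) (+-comm 1 (q * s)) q∣) (m∣m*n s)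

  -- From 2 C(q, 2) = q (q - 1) by Euclid's lemma. Lifting the exponent needs q odd here: C(2, 2) =
  -- 1.
  ∣triangular : ∀ {q} → Prime q → q ∤ 2 → q ∣ triangular q
  ∣triangular {zero}  _  _   = divides 0 refl
  ∣triangular {suc k} qp q∤2 = [ (λ q∣2 → contradiction q∣2 q∤2) , (λ h → h) ]′
    (euclidsLemma 2 (triangular (suc k)) qp
      (subst (suc k ∣_) (sym (2*triangular k)) (m∣m*n k)))

  module _ {q} (qp : Prime q) where

    private instance
      q≢0 : NonZero q
      q≢0 = prime⇒nonZero qp

    ∤*⇒∤ : ∀ {a b} → q ∤ a → q ∤ b → q ∤ a * b
    ∤*⇒∤ {a} {b} q∤a q∤b q∣ab = [ q∤a , q∤b ]′ (euclidsLemma a b qp q∣ab)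

    odd-prime∤2 : 2 ∤ q → q ∤ 2
    odd-prime∤2 2∤q q∣2 with prime⇒irreducible prime[2] q∣2
    ... | inj₁ q≡1 = contradiction (subst Prime q≡1 qp) ¬prime[1]
    ... | inj₂ q≡2 = 2∤q (∣-reflexive (sym q≡2))

    -- The new cofactor a (k + y w) is a k modulo q, because q divides y.
    ^-coprime-exponent : ∀ j {a k} → q ∤ a → q ∤ k →
      ∃[ b ] q ∤ b × (1 + q ^ suc j * a) ^ k ≡ 1 + q ^ suc j * b
    ^-coprime-exponent j {a} {k} q∤a q∤k with r , eq ← binomial-mod-cube (q ^ suc j * a) k =
      a * (k + y * w) , ∤*⇒∤ q∤a q∤k+yw , trans eq (cong suc (*-assoc (q ^ suc j) a (k + y * w)))
      where
      y = q ^ suc j * a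
      w = triangular k + y * r
      q∣y : q ∣ y
      q∣y = ∣m⇒∣m*n a (m∣m*n (q ^ j))
      q∤k+yw : q ∤ k + y * w
      q∤k+yw q∣ = q∤k (∣m+n∣m⇒∣n (subst (q ∣_) (+-comm k (y * w)) q∣) (∣m⇒∣m*n w q∣y))

    -- In the expansion at y = q b, the terms q, y C(q, 2) and y² r add up to q (1 + q s). This
    -- gains one factor q, and the new cofactor is a modulo q.
    ^-prime-exponent : 2 ∤ q → ∀ j {a} → q ∤ a →
      ∃[ b ] q ∤ b × (1 + q ^ suc j * a) ^ q ≡ 1 + q ^ suc (suc j) * b
    ^-prime-exponent 2∤q j {a} q∤a
      with r , eq ← binomial-mod-cube (q ^ suc j * a) q
         | divides t t≡ ← ∣triangular qp (odd-prime∤2 2∤q) =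
      a * (1 + q * s) , ∤*⇒∤ q∤a (∤1+multiple qp s) ,
      trans eq (trans (cong (λ z → 1 + q ^ suc j * a * (q + q ^ suc j * a * (z + q ^ suc j * a * r))) t≡)
        (rearranged q (q ^ j) a t r))
      where
      b = q ^ j * a
      s = b * (t + b * r)
      rearranged : ∀ q x a t r →
        1 + q * x * a * (q + q * x * a * (t * q + q * x * a * r))
        ≡ 1 + q * (q * x) * (a * (1 + q * ((x * a) * (t + x * a * r))))
      rearranged = solve-∀

    IsValuation-cancel-* : ∀ k ν → IsValuation q (k * q) (suc ν) → IsValuation q k ν
    IsValuation-cancel-* k ν (div , ndiv) =
      *-cancelʳ-∣ q (subst (_∣ k * q) (*-comm q (q ^ ν)) div) ,
      λ d → ndiv (subst (_∣ k * q) (*-comm (q ^ suc ν) q) (*-monoˡ-∣ q d))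

    -- Each factor q of k is spent on one q-th power, which raises j by one; what remains of k is
    -- prime to q and leaves j alone. The exponent `suc j` encodes that the base is 1 modulo q.
    lifting-the-exponent : 2 ∤ q → ∀ j ν {a k} → q ∤ a → IsValuation q k ν →
      ∃[ b ] q ∤ b × (1 + q ^ suc j * a) ^ k ≡ 1 + q ^ suc (j + ν) * b
    lifting-the-exponent 2∤q j zero {a} {k} q∤a (_ , ndiv)
      with b , q∤b , eq ← ^-coprime-exponent j q∤a (subst (_∤ k) (*-identityʳ q) ndiv) =
      b , q∤b , trans eq (cong (λ e → 1 + q ^ suc e * b) (sym (+-identityʳ j)))
    lifting-the-exponent 2∤q j (suc ν) {a} q∤a val@(q∣k , _)
      with divides k refl ← m*n∣⇒m∣ q (q ^ ν) q∣k
      with c , q∤c , eq ← ^-prime-exponent 2∤q j q∤a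
      with b , q∤b , eq′ ← lifting-the-exponent 2∤q (suc j) ν {k = k} q∤c (IsValuation-cancel-* k ν val) =
      b , q∤b , (begin
        x ^ (k * q)                  ≡⟨ cong (x ^_) (*-comm k q) ⟩
        x ^ (q * k)                  ≡⟨ ^-*-assoc x q k ⟨
        (x ^ q) ^ k                  ≡⟨ cong (_^ k) eq ⟩
        (1 + q ^ suc (suc j) * c) ^ k ≡⟨ eq′ ⟩
        1 + q ^ suc (suc j + ν) * b  ≡⟨ cong (λ e → 1 + q ^ suc e * b) (+-suc j ν) ⟨
        1 + q ^ suc (j + suc ν) * b  ∎)
      where
      open ≡-Reasoning
      x = 1 + q ^ suc j * a

    ^∣-cancel-∤ : ∀ ν {d} k → q ∤ d → q ^ ν ∣ d * k → q ^ ν ∣ k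
    ^∣-cancel-∤ zero    k q∤d _ = 1∣ k
    ^∣-cancel-∤ (suc ν) {d} k q∤d div
      with euclidsLemma d k qp (m*n∣⇒m∣ q (q ^ ν) div)
    ... | inj₁ q∣d = contradiction q∣d q∤d
    ... | inj₂ (divides k′ refl) =
      subst (q ^ suc ν ∣_) (*-comm q k′)
        (*-monoʳ-∣ q (^∣-cancel-∤ ν k′ q∤d (*-cancelˡ-∣ q (subst (q ^ suc ν ∣_) swap div))))
      where
      swap : d * (k′ * q) ≡ q * (d * k′)
      swap = solve (d ∷ k′ ∷ q ∷ [])

    ∤-cofactor-valuation : ∀ {d k ν} → q ∤ d → IsValuation q (d * k) ν → IsValuation q k ν
    ∤-cofactor-valuation {d} {k} {ν} q∤d (div , ndiv) =
      ^∣-cancel-∤ ν k q∤d div , λ h → ndiv (∣n⇒∣m*n d h)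

    *-∤-valuation : ∀ {d k ν} → q ∤ d → IsValuation q k ν → IsValuation q (d * k) ν
    *-∤-valuation {d} {k} {ν} q∤d (div , ndiv) =
      ∣n⇒∣m*n d div , λ h → ndiv (^∣-cancel-∤ (suc ν) k q∤d h)

    -- Meant for the factors Q - 1 and Q + 1 of Q² - 1: the one prime to q leaves all of `q ^ e`,
    -- and no further q, to the other.
    exact-cofactor : ∀ e {a b m} → q ∤ a → a * b ≡ q ^ e * m → q ∤ m → ∃[ c ] b ≡ q ^ e * c × q ∤ c
    exact-cofactor e {a} {b} {m} q∤a ab≡ q∤m
      with divides c refl ← ^∣-cancel-∤ e b q∤a (subst (q ^ e ∣_) (sym ab≡) (m∣m*n m)) =
      c , *-comm c (q ^ e) , λ q∣c → q∤m (subst (q ∣_) (*-cancelˡ-≡ (a * c) m (q ^ e) {{m^n≢0 q e}}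
        (trans (rearranged (q ^ e) a c) ab≡)) (∣n⇒∣m*n a q∣c))
      where
      rearranged : ∀ x a c → x * (a * c) ≡ a * (c * x)
      rearranged = solve-∀

  coprime-^ : ∀ {a m} i → Coprime a m → Coprime (a ^ i) m
  coprime-^ zero    _ (d∣1 , _) = ∣1⇒≡1 d∣1
  coprime-^ {a} {m} (suc i) c {d} (d∣a^ , d∣m) = coprime-^ i c (d∣a^i , d∣m)
    where
    d∣a^i : d ∣ a ^ i
    d∣a^i = coprime-divisor (λ (e∣d , e∣a) → c (e∣a , ∣-trans e∣d d∣m)) d∣a^

  ∤⇒coprime : ∀ {q m} → Prime q → q ∤ m → Coprime q m
  ∤⇒coprime qp q∤m (d∣q , d∣m) with prime⇒irreducible qp d∣q
  ... | inj₁ d≡1  = d≡1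
  ... | inj₂ refl = contradiction d∣m q∤m

  ∣^∸1⇒≡ : ∀ {a m} e .{{_ : NonZero a}} → m ∣ a ^ e ∸ 1 → ∃[ j ] a ^ e ≡ 1 + m * j
  ∣^∸1⇒≡ {a} {m} e (divides j eq) =
    j , trans (sym (m+[n∸m]≡n (m^n>0 a e))) (cong suc (trans eq (*-comm j m)))

  module _ {a m} (c : Coprime a (suc (suc m))) where

    private
      M = suc (suc m)

      res : ℕ → Fin M
      res k = (a ^ k) mod M

      toℕ-res : ∀ k → toℕ (res k) ≡ a ^ k % M
      toℕ-res k = Fin.toℕ-fromℕ< (m%n<n (a ^ k) M)

      0≢res : ∀ k → Fin.zero ≢ res k
      0≢res k 0≡ = contradiction
        (coprime-^ k c (m%n≡0⇒n∣m (a ^ k) M (trans (sym (toℕ-res k)) (sym (cong toℕ 0≡))) , ∣-refl))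
        (λ ())

      -- For y < x the truncated difference is 0, so no order between x and y is assumed.
      ∣-difference : ∀ x y → x % M ≡ y % M → M ∣ y ∸ x
      ∣-difference x y eq = subst (M ∣_) (sym (begin
        y ∸ x
          ≡⟨ cong₂ _∸_ (m≡m%n+[m/n]*n y M) (trans (m≡m%n+[m/n]*n x M) (cong (_+ x / M * M) eq)) ⟩
        (y % M + y / M * M) ∸ (y % M + x / M * M)
          ≡⟨ [m+n]∸[m+o]≡n∸o (y % M) (y / M * M) (x / M * M) ⟩
        y / M * M ∸ x / M * M
          ≡⟨ *-distribʳ-∸ M (y / M) (x / M) ⟨
        (y / M ∸ x / M) * M ∎)) (n∣m*n (y / M ∸ x / M))
        where open ≡-Reasoning

    -- Abstract, since normalising the pigeonhole argument in a later `with` exhausts memory.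
    abstract
      -- The residues of 1, a, a², … modulo M avoid 0, so two of the first M coincide.
      power≡1-bounded : ∃[ e ] 0 < e × e < M × M ∣ a ^ e ∸ 1
      power≡1-bounded
        with i , j , i<j , same ← Fin.pigeonhole (n<1+n (suc m)) (λ i → Fin.punchOut (0≢res (toℕ i))) =
        e i j , m<n⇒0<n∸m i<j , ≤-<-trans (m∸n≤m (toℕ j) (toℕ i)) (Fin.toℕ<n j) ,
        coprime-divisor (Coprimality.sym (coprime-^ (toℕ i) c))
          (subst (M ∣_) (sym (difference i j i<j)) (∣-difference (a ^ toℕ i) (a ^ toℕ j) (residues i j same)))
        where
        e : (i j : Fin M) → ℕ
        e i j = toℕ j ∸ toℕ i

        residues : ∀ (i j : Fin M) → Fin.punchOut (0≢res (toℕ i)) ≡ Fin.punchOut (0≢res (toℕ j)) →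
          a ^ toℕ i % M ≡ a ^ toℕ j % M
        residues i j same = trans (sym (toℕ-res (toℕ i)))
          (trans (cong toℕ (Fin.punchOut-injective (0≢res (toℕ i)) (0≢res (toℕ j)) same))
            (toℕ-res (toℕ j)))

        difference : ∀ (i j : Fin M) → i Fin.< j → a ^ toℕ i * (a ^ e i j ∸ 1) ≡ a ^ toℕ j ∸ a ^ toℕ i
        difference i j i<j = begin
          a ^ toℕ i * (a ^ e i j ∸ 1)             ≡⟨ *-distribˡ-∸ (a ^ toℕ i) (a ^ e i j) 1 ⟩
          a ^ toℕ i * a ^ e i j ∸ a ^ toℕ i * 1   ≡⟨ cong₂ _∸_ (sym (^-distribˡ-+-* a (toℕ i) (e i j))) (*-identityʳ (a ^ toℕ i)) ⟩
          a ^ (toℕ i + e i j) ∸ a ^ toℕ i         ≡⟨ cong (λ k → a ^ k ∸ a ^ toℕ i) (m+[n∸m]≡n (<⇒≤ i<j)) ⟩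
          a ^ toℕ j ∸ a ^ toℕ i                   ∎
          where open ≡-Reasoning

  -- Modulus 1 is treated apart, since it has no nonzero residues for the pigeonhole argument.
  power≡1 : ∀ a m .{{_ : NonZero a}} → 0 < m → Coprime a m →
    ∃[ e ] 0 < e × ∃[ j ] a ^ e ≡ 1 + m * j
  power≡1 a (suc zero)    _ _ = 1 , z<s , ∣^∸1⇒≡ {a} {1} 1 (1∣ (a ^ 1 ∸ 1))
  power≡1 a (suc (suc m)) _ c = map₂ (λ {e} (0<e , _ , div) → 0<e , ∣^∸1⇒≡ e div) (power≡1-bounded {a} {m} c)

  -- The pigeonhole bound stands in for Fermat's little theorem: some positive e < q has q ∣ p^e -
  -- 1, so δ ≤ e < q by minimality.
  ∤-multOrder : ∀ {p q δ} → Prime p → Prime q → q ≢ p → IsMultOrder q p δ → q ∤ δ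
  ∤-multOrder {q = zero}     _ qp = contradiction qp ¬prime[0]
  ∤-multOrder {q = suc zero} _ qp = contradiction qp ¬prime[1]
  ∤-multOrder {p} {q@(suc (suc m))} {δ} pp qp q≢p ord q∣δ
    with e , 0<e , e<q , div ← power≡1-bounded
      (∤⇒coprime pp (λ p∣q → [ (λ p≡1 → contradiction (subst Prime p≡1 pp) ¬prime[1])
                             , (λ p≡q → q≢p (sym p≡q)) ]′ (prime⇒irreducible qp p∣q))) =
    <⇒≱ (≤-<-trans (minimal 0<e div) e<q) (∣⇒≤ {{>-nonZero positive}} q∣δ)
    where open IsMultOrder ord

  valuation-cofactor-∤ : ∀ {q n k a} → IsValuation q n k → n ≡ q ^ k * a → q ∤ a
  valuation-cofactor-∤ {q} {n} {k} {a} (_ , ndiv) n≡ q∣a =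
    ndiv (subst (q ^ suc k ∣_) (sym n≡)
      (subst (_∣ q ^ k * a) (*-comm (q ^ k) q) (*-monoʳ-∣ (q ^ k) q∣a)))

  -- With n = k δ and p^δ = 1 + q^μ a, lifting the exponent applies to the k-th power; v_q(k) =
  -- v_q(n) because q ∤ δ.
  valuation-of-p^n∸1 : ∀ {p q δ μ} → Prime p → Prime q → 2 ∤ q → q ≢ p →
    IsMultOrder q p δ → IsValuation q (p ^ δ ∸ 1) μ →
    ∀ {n ν} → δ ∣ n → IsValuation q n ν → ∃[ m ] q ∤ m × p ^ n ≡ 1 + q ^ (μ + ν) * m
  -- μ = 0 is excluded by q ∣ p^δ - 1.
  valuation-of-p^n∸1 {q = q} {μ = zero} pp qp 2∤q q≢p ord (_ , ndiv) _ _ =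
    contradiction (subst (_∣ _) (sym (*-identityʳ q)) (IsMultOrder.divides ord)) ndiv
  valuation-of-p^n∸1 {p} {q} {δ} {suc μ} pp qp 2∤q q≢p ord (div , ndiv) {ν = ν} (divides k refl) val
    with a , eq ← ∣^∸1⇒≡ {p} {q ^ suc μ} δ {{prime⇒nonZero pp}} div
    with b , q∤b , eq′ ← lifting-the-exponent qp 2∤q μ ν {a}
      (valuation-cofactor-∤ {k = suc μ} (div , ndiv) (cong (_∸ 1) eq))
      (∤-cofactor-valuation qp {ν = ν} (∤-multOrder pp qp q≢p ord)
        (subst (λ n → IsValuation q n ν) (*-comm k δ) val)) =
    b , q∤b , (begin
      p ^ (k * δ)                   ≡⟨ cong (p ^_) (*-comm k δ) ⟩
      p ^ (δ * k)                   ≡⟨ ^-*-assoc p δ k ⟨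
      (p ^ δ) ^ k                   ≡⟨ cong (_^ k) eq ⟩
      (1 + q ^ suc μ * a) ^ k       ≡⟨ eq′ ⟩
      1 + q ^ suc (μ + ν) * b       ∎)
    where open ≡-Reasoning

-- Limits of quotients whose numerator has bounded error.

module Limits where
  open import Data.Nat.Base
  open import Data.Nat.Properties
  open import Data.Nat.Divisibility
  open import Data.Nat.Primality
  import Data.Integer.Base as ℤ
  import Data.Integer.Properties as ℤ
  import Data.Rational.Base as ℚ
  import Data.Rational.Properties as ℚ
  import Data.Rational.Unnormalised.Base as ℚᵘ
  import Data.Rational.Unnormalised.Properties as ℚᵘ
  open import Data.Integer.Base using (+_; -[1+_])
  open ≡ using (sym; trans; cong; cong₂; subst)
  open Arithmetic

  ∣⊖∣-≤-within : ∀ {m n c} → m ≤ n + c → n ≤ m + c → ℤ.∣ m ℤ.⊖ n ∣ ≤ c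
  ∣⊖∣-≤-within {m} {n} m≤ n≤ with ≤-total m n
  ... | inj₁ m≤n = subst (_≤ _) (sym (ℤ.∣⊖∣-≤ m≤n)) (m≤n+o⇒m∸n≤o n m n≤)
  ... | inj₂ n≤m = subst (_≤ _) (trans (sym (ℤ.∣⊖∣-≤ n≤m)) (ℤ.∣m⊖n∣≡∣n⊖m∣ n m)) (m≤n+o⇒m∸n≤o m n m≤)

  -- Unnormalised fractions cancel nothing, so the numerator is literally the cross difference.
  -- `mkℚᵘ` stores the denominator minus one, and `d + b * suc d` is (b + 1)(d + 1) - 1.
  toℚᵘ-∣-∣ : ∀ x b y d →
    ℚ.toℚᵘ ℚ.∣ (+ x ℚ./ suc b) ℚ.- (+ y ℚ./ suc d) ∣
    ℚᵘ.≃ ℚᵘ.mkℚᵘ (+ ℤ.∣ x * suc d ℤ.⊖ y * suc b ∣) (d + b * suc d)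
  toℚᵘ-∣-∣ x b y d = begin
    ℚ.toℚᵘ ℚ.∣ X ℚ.- Y ∣                    ≈⟨ ℚ.toℚᵘ-homo-∣-∣ (X ℚ.- Y) ⟩
    ℚᵘ.∣ ℚ.toℚᵘ (X ℚ.- Y) ∣                 ≈⟨ ℚᵘ.∣-∣-cong difference ⟩
    ℚᵘ.∣ ℚᵘ.mkℚᵘ (+ x) b ℚᵘ.- ℚᵘ.mkℚᵘ (+ y) d ∣
      ≡⟨ cong (λ i → ℚᵘ.mkℚᵘ (+ ℤ.∣ i ∣) (d + b * suc d)) numerator ⟩
    ℚᵘ.mkℚᵘ (+ ℤ.∣ x * suc d ℤ.⊖ y * suc b ∣) (d + b * suc d) ∎
    where
    open import Relation.Binary.Reasoning.Setoid ℚᵘ.≃-setoid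
    X = + x ℚ./ suc b
    Y = + y ℚ./ suc d
    difference : ℚ.toℚᵘ (X ℚ.- Y) ℚᵘ.≃ ℚᵘ.mkℚᵘ (+ x) b ℚᵘ.- ℚᵘ.mkℚᵘ (+ y) d
    difference = ℚᵘ.≃-trans (ℚ.toℚᵘ-homo-+ X (ℚ.- Y))
      (ℚᵘ.+-cong (ℚ.toℚᵘ-fromℚᵘ (ℚᵘ.mkℚᵘ (+ x) b))
        (ℚᵘ.≃-trans (ℚ.toℚᵘ-homo‿- Y) (ℚᵘ.-‿cong (ℚ.toℚᵘ-fromℚᵘ (ℚᵘ.mkℚᵘ (+ y) d)))))
    numerator : + x ℤ.* + suc d ℤ.+ (ℤ.- + y) ℤ.* + suc b ≡ x * suc d ℤ.⊖ y * suc b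
    numerator = trans (cong₂ ℤ._+_ (sym (ℤ.pos-* x (suc d)))
      (trans (sym (ℤ.neg-distribˡ-* (+ y) (+ suc b))) (cong ℤ.-_ (sym (ℤ.pos-* y (suc b))))))
      (ℤ.m-n≡m⊖n (x * suc d) (y * suc b))

  -- The distance is at most C / (b d), while a positive ε with denominator D is at least 1 / D; so
  -- C D < b suffices.
  ∣-∣-< : ∀ x b y d .{{_ : NonZero b}} .{{_ : NonZero d}} C {ε} → ℚ.0ℚ ℚ.< ε →
    x * d ≤ y * b + C → y * b ≤ x * d + C → C * ℚ.↧ₙ ε < b →
    ℚ.∣ (+ x ℚ./ b) ℚ.- (+ y ℚ./ d) ∣ ℚ.< ε
  ∣-∣-< x (suc b) y (suc d) C {ℚ.mkℚ (+ zero) D _} (ℚ.*<* (ℤ.+<+ ()))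
  ∣-∣-< x (suc b) y (suc d) C {ℚ.mkℚ -[1+ _ ] D _} (ℚ.*<* ())
  ∣-∣-< x (suc b) y (suc d) C {ε@(ℚ.mkℚ (+ suc e) D _)} _ x≤ y≤ C<b =
    ℚ.toℚᵘ-cancel-< (ℚᵘ.<-respˡ-≃ (ℚᵘ.≃-sym (toℚᵘ-∣-∣ x b y d)) (ℚᵘ.*<*
      (≡.subst₂ ℤ._<_ (ℤ.pos-* N (suc D)) (ℤ.pos-* (suc e) (suc b * suc d)) (ℤ.+<+ N<))))
    where
    N = ℤ.∣ x * suc d ℤ.⊖ y * suc b ∣
    open ≤-Reasoning
    N< : N * suc D < suc e * (suc b * suc d)
    N< = begin-strict
      N * suc D               ≤⟨ *-monoˡ-≤ (suc D) (∣⊖∣-≤-within x≤ y≤) ⟩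
      C * suc D               <⟨ C<b ⟩
      suc b                   ≤⟨ m≤m*n (suc b) (suc d) ⟩
      suc b * suc d           ≤⟨ m≤n*m (suc b * suc d) (suc e) ⟩
      suc e * (suc b * suc d) ∎

  n<m^n : ∀ {m} → 1 < m → ∀ n → n < m ^ n
  n<m^n 1<m zero    = z<s
  n<m^n {m} 1<m (suc n) = ≤-<-trans (n<m^n 1<m n) (^-monoʳ-< m 1<m (n<1+n n))

  limitAlong-of-bounded-error : ∀ {p} (pp : Prime p) {P : ℕ → Set} (a : ∀ n → .{{NonZero n}} → ℕ)
    y d .{{_ : NonZero d}} C → (∀ N → ∃[ n ] N ≤ n × NonZero n × P n) →
    (∀ n .{{_ : NonZero n}} → P n → a n * d ≤ y * p ^ n + C × y * p ^ n ≤ a n * d + C) →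
    LimitAlong P (λ n → ℚ._/_ (+ a n) (p ^ n) {{prime^≢0 pp n}}) (+ y ℚ./ d)
  limitAlong-of-bounded-error {p} pp a y d C unbounded within = unbounded , λ ε 0<ε →
    -- This threshold works because n < p^n.
    C * ℚ.↧ₙ ε , λ n N≤n Pn →
      ∣-∣-< (a n) (p ^ n) y d {{prime^≢0 pp n}} C {ε} 0<ε (proj₁ (within n Pn)) (proj₂ (within n Pn))
        (≤-<-trans N≤n (n<m^n (nonTrivial⇒n>1 p {{prime⇒nonTrivial pp}}) n))

  ∣∧valuation-unbounded : ∀ {q δ} → Prime q → 0 < δ → q ∤ δ → ∀ ν N →
    ∃[ n ] N ≤ n × NonZero n × (δ ∣ n × IsValuation q n ν)
  ∣∧valuation-unbounded {q} {δ} qp 0<δ q∤δ ν N =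
    n , N≤n , >-nonZero (≤-<-trans z≤n N<n) , m∣m*n (q ^ ν * suc (q * N)) ,
    *-∤-valuation qp {ν = ν} q∤δ
      ( m∣m*n (suc (q * N))
      , λ h → ∤1+multiple qp N (*-cancelˡ-∣ (q ^ ν) (subst (_∣ q ^ ν * suc (q * N)) (*-comm q (q ^ ν)) h)))
    where
    instance
      q≢0 : NonZero q
      q≢0 = prime⇒nonZero qp
      q^ν≢0 : NonZero (q ^ ν)
      q^ν≢0 = m^n≢0 q ν
      δ≢0 : NonZero δ
      δ≢0 = >-nonZero 0<δ
    -- The factor 1 + q N carries n beyond N and stays prime to q.
    n = δ * (q ^ ν * suc (q * N))
    open ≤-Reasoning
    N<n : N < n
    N<n = begin-strict
      N                          <⟨ s≤s (m≤n*m N q) ⟩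
      suc (q * N)                ≤⟨ m≤n*m (suc (q * N)) (q ^ ν) ⟩
      q ^ ν * suc (q * N)        ≤⟨ m≤n*m (q ^ ν * suc (q * N)) δ ⟩
      n                          ∎
    N≤n = <⇒≤ N<n

-- Integer constants in a commutative ring, and a ring solver using them.

module IntegerCoefficients {c ℓ} (R : CommutativeRing c ℓ) where
  open import Data.Integer.Base using (ℤ; +_; -[1+_])
  open CommutativeRing R
  open Evaluation R using (fromℤ)
  open import Algebra.Properties.Semiring.Mult semiring renaming (_×_ to _×ᵤ_)
  open import Algebra.Properties.Semiring.Mult.TCOptimised semiring using (×ᵤ≈×) renaming (_×_ to _×ₜ_)
  open import Algebra.Properties.Ring ring
  open import Algebra.Solver.Ring.AlmostCommutativeRing using (fromCommutativeRing; _-Raw-AlmostCommutative⟶_)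
  open import Relation.Binary.Reasoning.Setoid setoid
  import Data.Maybe.Base as Maybe
  open import Relation.Nullary.Decidable using (dec⇒maybe)
  open import Algebra.Properties.AbelianGroup +-abelianGroup using (⁻¹-∙-comm)

  private
    ι : ℕ → Carrier
    ι n = n ×ᵤ 1#

  fromℤ-⊖ : ∀ m n → fromℤ (m ℤ.⊖ n) ≈ ι m - ι n
  fromℤ-⊖ m zero = sym (begin
    ι m + - 0#      ≈⟨ +-congˡ -0#≈0# ⟩
    ι m + 0#        ≈⟨ +-identityʳ (ι m) ⟩
    ι m             ∎)
  fromℤ-⊖ zero (suc n) = sym (+-identityˡ (- ι (suc n)))
  fromℤ-⊖ (suc m) (suc n) = begin
    fromℤ (suc m ℤ.⊖ suc n)          ≡⟨ ≡.cong fromℤ (ℤ.[1+m]⊖[1+n]≡m⊖n m n) ⟩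
    fromℤ (m ℤ.⊖ n)                  ≈⟨ fromℤ-⊖ m n ⟩
    ι m - ι n                        ≈⟨ +-congʳ (+-identityʳ (ι m)) ⟨
    (ι m + 0#) - ι n                 ≈⟨ +-congʳ (+-congˡ (-‿inverseʳ 1#)) ⟨
    (ι m + (1# - 1#)) - ι n          ≈⟨ +-congʳ (+-assoc (ι m) 1# (- 1#)) ⟨
    ((ι m + 1#) - 1#) - ι n          ≈⟨ +-assoc (ι m + 1#) (- 1#) (- ι n) ⟩
    (ι m + 1#) + (- 1# - ι n)        ≈⟨ +-cong (+-comm (ι m) 1#) (⁻¹-∙-comm 1# (ι n)) ⟩
    ι (suc m) - ι (suc n)            ∎

  fromℤ-neg : ∀ i → fromℤ (ℤ.- i) ≈ - fromℤ i
  fromℤ-neg (+ zero)  = sym -0#≈0#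
  fromℤ-neg (+ suc n) = refl
  fromℤ-neg -[1+ n ]  = sym (-‿involutive (ι (suc n)))

  fromℤ-+ : ∀ i j → fromℤ (i ℤ.+ j) ≈ fromℤ i + fromℤ j
  fromℤ-+ (+ m)    (+ n)    = ×-homo-+ 1# m n
  fromℤ-+ (+ m)    -[1+ n ] = fromℤ-⊖ m (suc n)
  fromℤ-+ -[1+ m ] (+ n)    = trans (fromℤ-⊖ n (suc m)) (+-comm (ι n) _)
  fromℤ-+ -[1+ m ] -[1+ n ] = begin
    - ι (suc (suc (m ℕ.+ n)))   ≡⟨ ≡.cong (λ k → - ι k) (ℕ.+-suc (suc m) n) ⟨
    - ι (suc m ℕ.+ suc n)       ≈⟨ -‿cong (×-homo-+ 1# (suc m) (suc n)) ⟩
    - (ι (suc m) + ι (suc n))   ≈⟨ ⁻¹-∙-comm (ι (suc m)) (ι (suc n)) ⟨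
    - ι (suc m) - ι (suc n)     ∎

  fromℤ-*-pos : ∀ m j → fromℤ (+ m ℤ.* j) ≈ ι m * fromℤ j
  fromℤ-*-pos m (+ n) = begin
    fromℤ (+ m ℤ.* + n) ≡⟨ ≡.cong fromℤ (ℤ.pos-* m n) ⟨
    ι (m ℕ.* n)         ≈⟨ ×1-homo-* m n ⟩
    ι m * ι n           ∎
  fromℤ-*-pos m -[1+ n ] = begin
    fromℤ (+ m ℤ.* -[1+ n ])         ≡⟨ ≡.cong fromℤ (ℤ.neg-distribʳ-* (+ m) (+ suc n)) ⟨
    fromℤ (ℤ.- (+ m ℤ.* + suc n))    ≈⟨ fromℤ-neg (+ m ℤ.* + suc n) ⟩
    - fromℤ (+ m ℤ.* + suc n)        ≈⟨ -‿cong (trans (reflexive (≡.cong fromℤ (≡.sym (ℤ.pos-* m (suc n))))) (×1-homo-* m (suc n))) ⟩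
    - (ι m * ι (suc n))              ≈⟨ -‿distribʳ-* (ι m) (ι (suc n)) ⟩
    ι m * - ι (suc n)                ∎

  fromℤ-* : ∀ i j → fromℤ (i ℤ.* j) ≈ fromℤ i * fromℤ j
  fromℤ-* (+ m)    j = fromℤ-*-pos m j
  fromℤ-* -[1+ m ] j = begin
    fromℤ (-[1+ m ] ℤ.* j)         ≡⟨ ≡.cong fromℤ (ℤ.neg-distribˡ-* (+ suc m) j) ⟨
    fromℤ (ℤ.- (+ suc m ℤ.* j))    ≈⟨ fromℤ-neg (+ suc m ℤ.* j) ⟩
    - fromℤ (+ suc m ℤ.* j)        ≈⟨ -‿cong (fromℤ-*-pos (suc m) j) ⟩
    - (ι (suc m) * fromℤ j)        ≈⟨ -‿distribˡ-* (ι (suc m)) (fromℤ j) ⟩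
    - ι (suc m) * fromℤ j          ∎

  -- With this variant of fromℤ the constants 0, 1 and 2 denote definitionally 0#, 1# and 1# + 1#.
  fromℤ′ : ℤ → Carrier
  fromℤ′ (+ n)    = n ×ₜ 1#
  fromℤ′ -[1+ n ] = - (suc n ×ₜ 1#)

  fromℤ≈fromℤ′ : ∀ i → fromℤ i ≈ fromℤ′ i
  fromℤ≈fromℤ′ (+ n)    = ×ᵤ≈× n 1#
  fromℤ≈fromℤ′ -[1+ n ] = -‿cong (×ᵤ≈× (suc n) 1#)

  morphism : ℤ.+-*-rawRing -Raw-AlmostCommutative⟶ fromCommutativeRing R
  morphism = record
    { ⟦_⟧    = fromℤ′
    ; +-homo = λ i j → trans (sym (fromℤ≈fromℤ′ (i ℤ.+ j)))
        (trans (fromℤ-+ i j) (+-cong (fromℤ≈fromℤ′ i) (fromℤ≈fromℤ′ j)))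
    ; *-homo = λ i j → trans (sym (fromℤ≈fromℤ′ (i ℤ.* j)))
        (trans (fromℤ-* i j) (*-cong (fromℤ≈fromℤ′ i) (fromℤ≈fromℤ′ j)))
    ; -‿homo = λ i → trans (sym (fromℤ≈fromℤ′ (ℤ.- i)))
        (trans (fromℤ-neg i) (-‿cong (fromℤ≈fromℤ′ i)))
    ; 0-homo = refl
    ; 1-homo = refl
    }

  -- Coefficients are compared in ℤ, so the solver works over R without deciding equality there.
  open import Algebra.Solver.Ring ℤ.+-*-rawRing (fromCommutativeRing R) morphism
    (λ i j → Maybe.map (λ i≡j → reflexive (≡.cong fromℤ′ i≡j)) (dec⇒maybe (i ℤ.≟ j)))
    public using (solve; _:=_; _:+_; _:*_; _:-_; :-_; con)

-- Binomial coefficients modulo p, and the Frobenius map.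

module BinomialCoefficients where
  open import Data.Nat.Base
  open import Data.Nat.Properties
  open import Data.Nat.Combinatorics using (_C_; nCk+nC[k+1]≡[n+1]C[k+1]; nC1≡n)
  open import Data.Nat.Combinatorics.Specification using (k>n⇒nCk≡0)
  open import Data.Nat.Divisibility
  open import Data.Nat.Primality
  open ≡ using (refl; sym; trans; cong; subst; module ≡-Reasoning)
  open ≡-Reasoning

  -- Pascal's rule and induction avoid factorials and division. This is the source of the factor p
  -- in the inner binomial coefficients.
  absorption : ∀ n k → suc k * (suc n C suc k) ≡ suc n * (n C k)
  absorption zero    zero    = refl
  absorption zero    (suc k) = trans (cong (2+ k *_) (k>n⇒nCk≡0 {1} {2+ k} (s<s z<s))) (*-zeroʳ (2+ k))
  absorption (suc n) zero    = trans (+-identityʳ (2+ n C 1)) (trans (nC1≡n (2+ n)) (sym (*-identityʳ (2+ n))))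
  absorption (suc n) (suc k) = begin
    2+ k * (2+ n C 2+ k)                       ≡⟨ cong (2+ k *_) (nCk+nC[k+1]≡[n+1]C[k+1] (suc n) (suc k)) ⟨
    2+ k * (a + suc n C 2+ k)                ≡⟨ *-distribˡ-+ (2+ k) a (suc n C 2+ k) ⟩
    2+ k * a + 2+ k * (suc n C 2+ k)           ≡⟨ cong (2+ k * a +_) (absorption n (suc k)) ⟩
    a + suc k * a + suc n * (n C suc k)        ≡⟨ cong (λ z → a + z + suc n * (n C suc k)) (absorption n k) ⟩
    a + suc n * (n C k) + suc n * (n C suc k)    ≡⟨ +-assoc a _ _ ⟩
    a + (suc n * (n C k) + suc n * (n C suc k))  ≡⟨ cong (a +_) (*-distribˡ-+ (suc n) (n C k) (n C suc k)) ⟨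
    a + suc n * (n C k + n C suc k)          ≡⟨ cong (λ z → a + suc n * z) (nCk+nC[k+1]≡[n+1]C[k+1] n k) ⟩
    2+ n * (suc n C suc k)                     ∎
    where a = suc n C suc k

  prime∣C : ∀ {n k} → Prime (suc n) → suc k < suc n → suc n ∣ suc n C suc k
  prime∣C {n} {k} pp k<n =
    [ (λ p∣k → contradiction (∣⇒≤ p∣k) (<⇒≱ k<n)) , (λ h → h) ]′
      (euclidsLemma (suc k) (suc n C suc k) pp
        (subst (suc n ∣_) (sym (absorption n k)) (m∣m*n (n C k))))

module Frobenius {c ℓ} (R : CommutativeRing c ℓ) where
  open CommutativeRing R
  open import Algebra.Properties.Semiring.Mult semiring using (×-congʳ; ×-homo-1; ×-assoc-*; ×-assocˡ) renaming (_×_ to _×ᵤ_)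
  open import Algebra.Properties.Semiring.Exp semiring using (_^_)
  open import Algebra.Properties.CommutativeMonoid.Sum +-commutativeMonoid
  open import Algebra.Properties.CommutativeSemiring.Binomial commutativeSemiring
    using (binomial; binomialTerm; theorem)
  open import Data.Nat.Combinatorics using (nCn≡1)
  open import Data.Nat.Divisibility using (_∣_; divides)
  open import Relation.Binary.Reasoning.Setoid setoid

  ∣⇒×≈0 : ∀ {p n} → p ×ᵤ 1# ≈ 0# → p ∣ n → ∀ x → n ×ᵤ x ≈ 0#
  ∣⇒×≈0 {p} char (divides k ≡.refl) x = begin
    (k ℕ.* p) ×ᵤ x        ≡⟨ ≡.cong (_×ᵤ x) (ℕ.*-comm k p) ⟩
    (p ℕ.* k) ×ᵤ x        ≈⟨ ×-assocˡ x p k ⟨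
    p ×ᵤ (k ×ᵤ x)          ≈⟨ ×-congʳ p (*-identityˡ (k ×ᵤ x)) ⟨
    p ×ᵤ (1# * (k ×ᵤ x))   ≈⟨ ×-assoc-* p 1# (k ×ᵤ x) ⟨
    (p ×ᵤ 1#) * (k ×ᵤ x)   ≈⟨ *-congʳ char ⟩
    0# * (k ×ᵤ x)         ≈⟨ zeroˡ (k ×ᵤ x) ⟩
    0#                   ∎

  -- The inner binomial terms are multiples of p. Only p · 1 = 0 is asked of the ring, so the
  -- quadratic extension is covered even when it is not a domain.
  frobenius-+ : ∀ {p} → Prime p → p ×ᵤ 1# ≈ 0# → ∀ x y → (x + y) ^ p ≈ x ^ p + y ^ p
  frobenius-+ {suc n} pp char x y = begin
    (x + y) ^ suc n                             ≈⟨ theorem (suc n) x y ⟩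
    term Fin.zero + sum (λ k → term (Fin.suc k)) ≈⟨ +-cong first (sum-init-last (λ k → term (Fin.suc k))) ⟩
    y ^ suc n + (sum (λ k → term (Fin.suc (Fin.inject₁ k))) + term (Fin.suc (Fin.fromℕ n)))
      ≈⟨ +-congˡ (+-cong (trans (sum-cong-≋ middle) (sum-replicate-zero n)) last) ⟩
    y ^ suc n + (0# + x ^ suc n)                ≈⟨ +-congˡ (+-identityˡ (x ^ suc n)) ⟩
    y ^ suc n + x ^ suc n                       ≈⟨ +-comm (y ^ suc n) (x ^ suc n) ⟩
    x ^ suc n + y ^ suc n                       ∎
    where
    term = binomialTerm x y (suc n)
    first : term Fin.zero ≈ y ^ suc n
    first = trans (×-homo-1 _) (*-identityˡ (y ^ suc n))
    middle : ∀ k → term (Fin.suc (Fin.inject₁ k)) ≈ 0#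
    middle k = ∣⇒×≈0 char
      (BinomialCoefficients.prime∣C pp (ℕ.s<s (≡.subst (ℕ._< n) (≡.sym (Fin.toℕ-inject₁ k)) (Fin.toℕ<n k))))
      (binomial x y (suc n) (Fin.suc (Fin.inject₁ k)))
    last : term (Fin.suc (Fin.fromℕ n)) ≈ x ^ suc n
    last rewrite Fin.toℕ-fromℕ n | nCn≡1 (suc n) | ℕ.n∸n≡0 n =
      trans (×-homo-1 _) (*-identityʳ (x ^ suc n))

-- Chebyshev sequences and their identities for x = z + w with z w = 1.

module Chebyshev {c ℓ} (R : CommutativeRing c ℓ) where
  open CommutativeRing R
  open Evaluation R using (eval; fromℤ)
  open IntegerCoefficients R
  open import Algebra.Properties.Semiring.Exp semiring
  open import Algebra.Properties.CommutativeSemiring.Exp commutativeSemiring using (^-distrib-*)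
  open import Algebra.Properties.Ring ring
  open import Relation.Binary.Reasoning.Setoid setoid
  open import Data.Integer.Base using (+_)

  2# : Carrier
  2# = 1# + 1#

  -- One recurrence for three families: starting values 2, x give T; 1, x give the second kind z^k +
  -- z^(k-2) + ... + w^k; and 1, x + 1 give the sum of all powers from w^k to z^k.
  lucas : Carrier → Carrier → Carrier → ℕ → Carrier
  lucas u v x zero          = u
  lucas u v x (suc zero)    = v
  lucas u v x (suc (suc n)) = x * lucas u v x (suc n) - lucas u v x n

  T : ℕ → Carrier → Carrier
  T n x = lucas 2# x x n

  lucas-cong : ∀ {u u′ v v′ x x′} → u ≈ u′ → v ≈ v′ → x ≈ x′ → ∀ n → lucas u v x n ≈ lucas u′ v′ x′ n
  lucas-cong u≈ v≈ x≈ zero          = u≈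
  lucas-cong u≈ v≈ x≈ (suc zero)    = v≈
  lucas-cong u≈ v≈ x≈ (suc (suc n)) =
    +-cong (*-cong x≈ (lucas-cong u≈ v≈ x≈ (suc n))) (-‿cong (lucas-cong u≈ v≈ x≈ n))

  T-cong : ∀ n {x y} → x ≈ y → T n x ≈ T n y
  T-cong n x≈y = lucas-cong refl x≈y x≈y n

  eval-neg : ∀ bs x → eval (Data.List.Base.map ℤ.-_ bs) x ≈ - eval bs x
  eval-neg []       x = sym -0#≈0#
  eval-neg (b ∷ bs) x = trans (+-cong (fromℤ-neg b) (*-congˡ (eval-neg bs x)))
    (solve 3 (λ b x e → :- b :+ x :* :- e := :- (b :+ x :* e)) refl (fromℤ b) x (eval bs x))

  eval-−ₚ : ∀ as bs x → eval (as −ₚ bs) x ≈ eval as x - eval bs x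
  eval-−ₚ []       bs       x = trans (eval-neg bs x) (sym (+-identityˡ _))
  eval-−ₚ (a ∷ as) []       x = solve 1 (λ e → e := e :- con (+ 0)) refl (eval (a ∷ as) x)
  eval-−ₚ (a ∷ as) (b ∷ bs) x =
    trans (+-cong (trans (fromℤ-+ a (ℤ.- b)) (+-congˡ (fromℤ-neg b))) (*-congˡ (eval-−ₚ as bs x)))
      (solve 5 (λ a b x e f → (a :- b) :+ x :* (e :- f) := (a :+ x :* e) :- (b :+ x :* f)) refl
        (fromℤ a) (fromℤ b) x (eval as x) (eval bs x))

  eval-chebyshev : ∀ d x → eval (chebyshev d) x ≈ T d x
  eval-chebyshev zero x =
    trans (+-cong (fromℤ≈fromℤ′ (+ 2)) (zeroʳ x)) (+-identityʳ 2#)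
  eval-chebyshev (suc zero) x =
    solve 1 (λ x → con (+ 0) :+ x :* (con (+ 1) :+ con (+ 0) :+ x :* con (+ 0)) := x) refl x
  eval-chebyshev (suc (suc d)) x = trans (eval-−ₚ (var· chebyshev (suc d)) (chebyshev d) x)
    (+-cong (trans (+-identityˡ _) (*-congˡ (eval-chebyshev (suc d) x))) (-‿cong (eval-chebyshev d x)))

  eval-power : ∀ d x → eval (power d) x ≈ x ^ d
  eval-power zero    x =
    solve 1 (λ x → con (+ 1) :+ con (+ 0) :+ x :* con (+ 0) := con (+ 1)) refl x
  eval-power (suc d) x = trans (+-identityˡ _) (*-congˡ (eval-power d x))

  x≈y⇒x-y≈0 : ∀ {x y} → x ≈ y → x - y ≈ 0#
  x≈y⇒x-y≈0 {x} {y} x≈y = trans (+-congʳ x≈y) (-‿inverseʳ y)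

  x-y≈0⇒x≈y : ∀ {x y} → x - y ≈ 0# → x ≈ y
  x-y≈0⇒x≈y {x} {y} eq = trans (solve 2 (λ x y → x := (x :- y) :+ y) refl x y)
    (trans (+-congʳ eq) (+-identityˡ y))

  -- The ring solver cannot use a hypothesis such as z * w ≈ 1; the multiple k of s − t is supplied by hand.
  modulo : ∀ {s t} → s ≈ t → ∀ {x y} k → x ≈ y + (s - t) * k → x ≈ y
  modulo s≈t {x} {y} k eq = trans eq
    (trans (+-congˡ (trans (*-congʳ (x≈y⇒x-y≈0 s≈t)) (zeroˡ k))) (+-identityʳ y))

  -- The form u² + v² - x u v is invariant under the recurrence step (u, v) ↦ (v, x v - u), so its
  -- value at k = 0 persists.
  lucas-norm : ∀ x k → T k x * T k x + T (suc k) x * T (suc k) x - x * (T k x * T (suc k) x)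
                     ≈ 2# * 2# - x * x
  lucas-norm x zero = solve 1 (λ x → con (+ 2) :* con (+ 2) :+ x :* x :- x :* (con (+ 2) :* x)
                                  := con (+ 2) :* con (+ 2) :- x :* x) refl x
  lucas-norm x (suc k) = trans
    (solve 3 (λ x u v → v :* v :+ (x :* v :- u) :* (x :* v :- u) :- x :* (v :* (x :* v :- u))
                     := u :* u :+ v :* v :- x :* (u :* v)) refl x (T k x) (T (suc k) x))
    (lucas-norm x k)

  -- The norm of (zᵏ⁺² − 1)(zᵏ − 1) = zᵏ⁺¹(T_{k+1} − T₁).
  T-product : ∀ x k → (T (suc (suc k)) x - 2#) * (T k x - 2#) ≈ (T (suc k) x - x) * (T (suc k) x - x)
  T-product x k = modulo (lucas-norm x k) (- 1#)
    (solve 3 (λ x u v →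
      ((x :* v :- u) :- con (+ 2)) :* (u :- con (+ 2)) :=
      (v :- x) :* (v :- x)
        :+ ((u :* u :+ v :* v :- x :* (u :* v)) :- (con (+ 2) :* con (+ 2) :- x :* x)) :* (:- con (+ 1)))
      refl x (T k x) (T (suc k) x))

  T-2 : ∀ k → T k 2# ≈ 2#
  T-2 zero          = refl
  T-2 (suc zero)    = refl
  T-2 (suc (suc k)) = trans (+-cong (*-congˡ (T-2 (suc k))) (-‿cong (T-2 k)))
    (solve 0 (con (+ 2) :* con (+ 2) :- con (+ 2) := con (+ 2)) refl)

  module Inverses {z w} (zw≈1 : z * w ≈ 1#) where

    T-powers : ∀ k → T k (z + w) ≈ z ^ k + w ^ k
    T-powers zero          = refl
    T-powers (suc zero)    = sym (+-cong (*-identityʳ z) (*-identityʳ w))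
    T-powers (suc (suc k)) = trans (+-cong (*-congˡ (T-powers (suc k))) (-‿cong (T-powers k)))
      (modulo zw≈1 (z ^ k + w ^ k)
        (solve 4 (λ z w a b →
          (z :+ w) :* (z :* a :+ w :* b) :- (a :+ b) :=
          (z :* (z :* a) :+ w :* (w :* b)) :+ (z :* w :- con (+ 1)) :* (a :+ b))
          refl z w (z ^ k) (w ^ k)))

    z^k*w^k≈1 : ∀ k → z ^ k * w ^ k ≈ 1#
    z^k*w^k≈1 k = trans (sym (^-distrib-* z w k)) (trans (^-congˡ k zw≈1) (1^k≈1 k))
      where
      1^k≈1 : ∀ k → 1# ^ k ≈ 1#
      1^k≈1 zero    = refl
      1^k≈1 (suc k) = trans (*-identityˡ _) (1^k≈1 k)

    -- A geometric sum with ratio z², multiplied out because z - w may not be invertible.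
    U-powers : ∀ k → (z - w) * lucas 1# (z + w) (z + w) k ≈ z ^ suc k - w ^ suc k
    U-powers zero       = solve 2 (λ z w → (z :- w) :* con (+ 1) := z :* con (+ 1) :- w :* con (+ 1)) refl z w
    U-powers (suc zero) = solve 2 (λ z w → (z :- w) :* (z :+ w)
      := z :* (z :* con (+ 1)) :- w :* (w :* con (+ 1))) refl z w
    U-powers (suc (suc k)) = trans
      (solve 4 (λ z w a b → (z :- w) :* ((z :+ w) :* a :- b)
        := (z :+ w) :* ((z :- w) :* a) :- (z :- w) :* b) refl z w _ _)
      (trans (+-cong (*-congˡ (U-powers (suc k))) (-‿cong (U-powers k)))
        (modulo zw≈1 (z ^ suc k - w ^ suc k)
          (solve 4 (λ z w a b →
            (z :+ w) :* (z :* a :- w :* b) :- (a :- b) :=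
            (z :* (z :* a) :- w :* (w :* b)) :+ (z :* w :- con (+ 1)) :* (a :- b))
            refl z w (z ^ suc k) (w ^ suc k))))

    -- The geometric sum w^k + ... + w + 1 + z + ... + z^k telescopes against z - 1.
    W-powers : ∀ k → (z - 1#) * lucas 1# ((z + w) + 1#) (z + w) k ≈ z ^ suc k - w ^ k
    W-powers zero       = solve 2 (λ z w → (z :- con (+ 1)) :* con (+ 1) := z :* con (+ 1) :- con (+ 1)) refl z w
    W-powers (suc zero) = modulo zw≈1 1#
      (solve 2 (λ z w → (z :- con (+ 1)) :* ((z :+ w) :+ con (+ 1))
        := (z :* (z :* con (+ 1)) :- w :* con (+ 1)) :+ (z :* w :- con (+ 1)) :* con (+ 1)) refl z w)
    W-powers (suc (suc k)) = trans
      (solve 4 (λ z w a b → (z :- con (+ 1)) :* ((z :+ w) :* a :- b)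
        := (z :+ w) :* ((z :- con (+ 1)) :* a) :- (z :- con (+ 1)) :* b) refl z w _ _)
      (trans (+-cong (*-congˡ (W-powers (suc k))) (-‿cong (W-powers k)))
        (modulo zw≈1 (z ^ suc k - w ^ k)
          (solve 4 (λ z w a b →
            (z :+ w) :* (z :* a :- w :* b) :- (a :- b) :=
            (z :* (z :* a) :- w :* (w :* b)) :+ (z :* w :- con (+ 1)) :* (a :- b))
            refl z w (z ^ suc k) (w ^ k))))

    -- With n = k + 1, z^(2n) + w^(2n) - 2 = (z^n - w^n)², and (z - w)² = x² - 4.
    U-square : ∀ k → let x = z + w; u = lucas 1# x x k in
      T (suc k ℕ.+ suc k) x - 2# ≈ (x * x - 2# * 2#) * (u * u)
    U-square k = sym (begin
      (x * x - 2# * 2#) * (u * u)                ≈⟨ modulo zw≈1 (2# * 2# * (u * u)) (solve 3 (λ z w u →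
        ((z :+ w) :* (z :+ w) :- con (+ 2) :* con (+ 2)) :* (u :* u) :=
        ((z :- w) :* u) :* ((z :- w) :* u)
          :+ (z :* w :- con (+ 1)) :* (con (+ 2) :* con (+ 2) :* (u :* u))) refl z w u) ⟩
      ((z - w) * u) * ((z - w) * u)              ≈⟨ *-cong (U-powers k) (U-powers k) ⟩
      (a - b) * (a - b)                          ≈⟨ modulo (z^k*w^k≈1 (suc k)) (- 2#) (solve 2 (λ a b →
        (a :- b) :* (a :- b) :=
        (a :* a :+ b :* b :- con (+ 2)) :+ (a :* b :- con (+ 1)) :* (:- con (+ 2))) refl a b) ⟩
      a * a + b * b - 2#                         ≈⟨ +-congʳ (+-cong (^-homo-* z (suc k) (suc k)) (^-homo-* w (suc k) (suc k))) ⟨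
      z ^ (suc k ℕ.+ suc k) + w ^ (suc k ℕ.+ suc k) - 2# ≈⟨ +-congʳ (T-powers (suc k ℕ.+ suc k)) ⟨
      T (suc k ℕ.+ suc k) x - 2#                 ∎)
      where
      x = z + w
      u = lucas 1# x x k
      a = z ^ suc k
      b = w ^ suc k

  module _ {z w} (zw≈1 : z * w ≈ 1#) where
    open Inverses zw≈1

    -- For odd index the difference is minus the product of z^(k+1) - w^k and its conjugate. These
    -- are (z - 1) u and (w - 1) u, and -(z - 1)(w - 1) = x - 2.
    W-square : ∀ k → let x = z + w; u = lucas 1# (x + 1#) x k in
      T (suc (k ℕ.+ k)) x - 2# ≈ (x - 2#) * (u * u)
    W-square k = begin
      T (suc (k ℕ.+ k)) x - 2#             ≈⟨ +-congʳ (T-powers (suc (k ℕ.+ k))) ⟩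
      (z * z ^ (k ℕ.+ k) + w * w ^ (k ℕ.+ k)) - 2#
        ≈⟨ +-congʳ (+-cong (*-congˡ (^-homo-* z k k)) (*-congˡ (^-homo-* w k k))) ⟩
      (z * (a * a) + w * (b * b)) - 2#     ≈⟨ modulo (z^k*w^k≈1 k) (1# + z * w) (modulo zw≈1 1#
        (solve 4 (λ z w a b →
          (z :* (a :* a) :+ w :* (b :* b)) :- con (+ 2) :=
          ((:- ((z :* a :- b) :* (w :* b :- a))
            :+ (a :* b :- con (+ 1)) :* (con (+ 1) :+ z :* w)) :+ (z :* w :- con (+ 1)) :* con (+ 1)))
          refl z w a b)) ⟩
      - ((z ^ suc k - b) * (w ^ suc k - a)) ≈⟨ -‿cong (*-cong (W-powers k) swapped) ⟨
      - (((z - 1#) * u) * ((w - 1#) * u))  ≈⟨ modulo zw≈1 (- (u * u)) (solve 3 (λ z w u →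
        :- (((z :- con (+ 1)) :* u) :* ((w :- con (+ 1)) :* u)) :=
        (z :+ w :- con (+ 2)) :* (u :* u) :+ (z :* w :- con (+ 1)) :* (:- (u :* u))) refl z w u) ⟩
      (x - 2#) * (u * u)                   ∎
      where
      x = z + w
      u = lucas 1# (x + 1#) x k
      a = z ^ k
      b = w ^ k
      -- The sum u is symmetric in z and w, so the formula is used with the two exchanged; this
      -- requires z and w not to be fixed.
      swapped : (w - 1#) * u ≈ w ^ suc k - a
      swapped = trans (*-congˡ (lucas-cong refl (+-congʳ (+-comm z w)) (+-comm z w) k))
        (Inverses.W-powers (trans (*-comm w z) zw≈1) k)

-- The ring R[z]/(z² − xz + 1), where x = z + z⁻¹; the pair (a , b) stands for a + bz.
module QuadraticExtension {c ℓ} (R : CommutativeRing c ℓ) (x : CommutativeRing.Carrier R) where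
  open CommutativeRing R hiding (isCommutativeRing)
  open IntegerCoefficients R
  open import Data.Integer.Base using (+_)
  open import Algebra.Structures using (IsCommutativeRing)

  infix  4 _≋_
  infixl 6 _⊕_
  infixl 7 _⊛_

  _≋_ : Carrier × Carrier → Carrier × Carrier → Set ℓ
  (a , b) ≋ (c , d) = a ≈ c × b ≈ d

  _⊕_ _⊛_ : Carrier × Carrier → Carrier × Carrier → Carrier × Carrier
  (a , b) ⊕ (c , d) = a + c , b + d
  (a , b) ⊛ (c , d) = a * c - b * d , a * d + b * c + x * (b * d)

  ⊝_ : Carrier × Carrier → Carrier × Carrier
  ⊝ (a , b) = - a , - b

  ι : Carrier → Carrier × Carrier
  ι a = a , 0#

  isCommutativeRing : IsCommutativeRing _≋_ _⊕_ _⊛_ ⊝_ (ι 0#) (ι 1#)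
  isCommutativeRing = record
    { isRing = record
      { +-isAbelianGroup = record
        { isGroup = record
          { isMonoid = record
            { isSemigroup = record
              { isMagma = record
                { isEquivalence = record
                  { refl = refl , refl
                  ; sym = λ (p , q) → sym p , sym q
                  ; trans = λ (p , q) (r , s) → trans p r , trans q s
                  }
                ; ∙-cong = λ (p , q) (r , s) → +-cong p r , +-cong q s
                }
              ; assoc = λ (a , b) (c , d) (e , f) → +-assoc a c e , +-assoc b d f
              }
            ; identity = (λ (a , b) → +-identityˡ a , +-identityˡ b)
                       , (λ (a , b) → +-identityʳ a , +-identityʳ b)
            }
          ; inverse = (λ (a , b) → -‿inverseˡ a , -‿inverseˡ b)
                    , (λ (a , b) → -‿inverseʳ a , -‿inverseʳ b)
          ; ⁻¹-cong = λ (p , q) → -‿cong p , -‿cong q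
          }
        ; comm = λ (a , b) (c , d) → +-comm a c , +-comm b d
        }
      ; *-cong = λ (p , q) (r , s) →
          +-cong (*-cong p r) (-‿cong (*-cong q s)) ,
          +-cong (+-cong (*-cong p s) (*-cong q r)) (*-congˡ (*-cong q s))
      ; *-assoc = λ (a , b) (c , d) (e , f) →
          solve 7 (λ x a b c d e f →
            (a :* c :- b :* d) :* e :- (a :* d :+ b :* c :+ x :* (b :* d)) :* f :=
            a :* (c :* e :- d :* f) :- b :* (c :* f :+ d :* e :+ x :* (d :* f)))
            refl x a b c d e f ,
          solve 7 (λ x a b c d e f →
            (a :* c :- b :* d) :* f :+ (a :* d :+ b :* c :+ x :* (b :* d)) :* e
              :+ x :* ((a :* d :+ b :* c :+ x :* (b :* d)) :* f) :=
            a :* (c :* f :+ d :* e :+ x :* (d :* f)) :+ b :* (c :* e :- d :* f)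
              :+ x :* (b :* (c :* f :+ d :* e :+ x :* (d :* f))))
            refl x a b c d e f
      ; *-identity = (λ (a , b) →
          solve 2 (λ a b → con (+ 1) :* a :- con (+ 0) :* b := a) refl a b ,
          solve 3 (λ x a b → con (+ 1) :* b :+ con (+ 0) :* a :+ x :* (con (+ 0) :* b) := b) refl x a b)
        , (λ (a , b) →
          solve 2 (λ a b → a :* con (+ 1) :- b :* con (+ 0) := a) refl a b ,
          solve 3 (λ x a b → a :* con (+ 0) :+ b :* con (+ 1) :+ x :* (b :* con (+ 0)) := b) refl x a b)
      ; distrib = (λ (a , b) (c , d) (e , f) →
          solve 6 (λ a b c d e f →
            a :* (c :+ e) :- b :* (d :+ f) := (a :* c :- b :* d) :+ (a :* e :- b :* f))
            refl a b c d e f ,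
          solve 7 (λ x a b c d e f →
            a :* (d :+ f) :+ b :* (c :+ e) :+ x :* (b :* (d :+ f)) :=
            (a :* d :+ b :* c :+ x :* (b :* d)) :+ (a :* f :+ b :* e :+ x :* (b :* f)))
            refl x a b c d e f)
        , (λ (a , b) (c , d) (e , f) →
          solve 6 (λ a b c d e f →
            (c :+ e) :* a :- (d :+ f) :* b := (c :* a :- d :* b) :+ (e :* a :- f :* b))
            refl a b c d e f ,
          solve 7 (λ x a b c d e f →
            (c :+ e) :* b :+ (d :+ f) :* a :+ x :* ((d :+ f) :* b) :=
            (c :* b :+ d :* a :+ x :* (d :* b)) :+ (e :* b :+ f :* a :+ x :* (f :* b)))
            refl x a b c d e f)
      }
    ; *-comm = λ (a , b) (c , d) →
        solve 4 (λ a b c d → a :* c :- b :* d := c :* a :- d :* b) refl a b c d ,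
        solve 5 (λ x a b c d →
          a :* d :+ b :* c :+ x :* (b :* d) := c :* b :+ d :* a :+ x :* (d :* b)) refl x a b c d
    }

  extension : CommutativeRing c ℓ
  extension = record { isCommutativeRing = isCommutativeRing }

  module E = CommutativeRing extension
  open Chebyshev R using (lucas; T; 2#)
  module CE = Chebyshev extension
  open import Algebra.Properties.Semiring.Exp semiring using (_^_)
  open import Algebra.Properties.Semiring.Exp E.semiring public using ()
    renaming (_^_ to _^ᴱ_; ^-assocʳ to ^ᴱ-assocʳ; ^-congˡ to ^ᴱ-congˡ)
  open import Algebra.Properties.Semiring.Mult semiring using () renaming (_×_ to _×ᵤ_)
  open import Algebra.Properties.Semiring.Mult E.semiring using () renaming (_×_ to _×ᴱ_)

  ι-cong : ∀ {a b} → a ≈ b → ι a ≋ ι b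
  ι-cong a≈b = a≈b , refl

  ι-+ : ∀ a b → ι (a + b) ≋ ι a ⊕ ι b
  ι-+ a b = refl , sym (+-identityʳ 0#)

  ι-- : ∀ a b → ι (a - b) ≋ ι a ⊕ (⊝ ι b)
  ι-- a b = refl , sym (-‿inverseʳ 0#)

  ι-* : ∀ a b → ι (a * b) ≋ ι a ⊛ ι b
  ι-* a b =
    solve 2 (λ a b → a :* b := a :* b :- con (+ 0) :* con (+ 0)) refl a b ,
    solve 3 (λ x a b → con (+ 0) := a :* con (+ 0) :+ con (+ 0) :* b :+ x :* (con (+ 0) :* con (+ 0)))
      refl x a b

  ι-^ : ∀ a n → ι (a ^ n) ≋ ι a ^ᴱ n
  ι-^ a zero    = E.refl
  ι-^ a (suc n) = E.trans (ι-* a (a ^ n)) (E.*-congˡ (ι-^ a n))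

  ι-× : ∀ n a → ι (n ×ᵤ a) ≋ n ×ᴱ ι a
  ι-× zero    a = E.refl
  ι-× (suc n) a = E.trans (ι-+ a (n ×ᵤ a)) (E.+-congˡ (ι-× n a))

  ι-lucas : ∀ u v y n → ι (lucas u v y n) ≋ CE.lucas (ι u) (ι v) (ι y) n
  ι-lucas u v y zero          = E.refl
  ι-lucas u v y (suc zero)    = E.refl
  ι-lucas u v y (suc (suc n)) = E.trans (ι-- (y * lucas u v y (suc n)) (lucas u v y n))
    (E.+-cong (E.trans (ι-* y (lucas u v y (suc n))) (E.*-congˡ (ι-lucas u v y (suc n))))
      (E.-‿cong (ι-lucas u v y n)))

  ι-2 : ι 2# ≋ CE.2#
  ι-2 = ι-+ 1# 1#

  ι-T : ∀ n y → ι (T n y) ≋ CE.T n (ι y)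
  ι-T n y = E.trans (ι-lucas 2# y y n) (CE.lucas-cong ι-2 E.refl E.refl n)

  z w : Carrier × Carrier
  z = 0# , 1#
  w = x , - 1#

  z⊛w≈1 : z ⊛ w ≋ ι 1#
  z⊛w≈1 =
    solve 1 (λ x → con (+ 0) :* x :- con (+ 1) :* (:- con (+ 1)) := con (+ 1)) refl x ,
    solve 1 (λ x → con (+ 0) :* (:- con (+ 1)) :+ con (+ 1) :* x :+ x :* (con (+ 1) :* (:- con (+ 1)))
      := con (+ 0)) refl x

  ι-x : ι x ≋ z ⊕ w
  ι-x = sym (+-identityˡ x) , sym (-‿inverseʳ 1#)

-- Chebyshev identities over an arbitrary commutative ring.

module ChebyshevProperties {c ℓ} (R : CommutativeRing c ℓ) where
  open CommutativeRing R
  open Chebyshev R public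
  open import Algebra.Properties.Semiring.Exp semiring
  open import Algebra.Properties.Semiring.Mult semiring using () renaming (_×_ to _×ᵤ_)

  private
    module Q (x : Carrier) where
      open QuadraticExtension R x public
      open CE.Inverses {z} {w} z⊛w≈1 public

  -- In the extension both sides become z^(ab) + w^(ab), as z^b and w^b are again inverse to each
  -- other. The extension is free on 1 and z, so `proj₁` brings the identity back to R; the next
  -- results descend the same way.
  T-∘ : ∀ a b x → T a (T b x) ≈ T (b ℕ.* a) x
  T-∘ a b x = proj₁ (begin
    ι (T a (T b x))                 ≈⟨ ι-T a (T b x) ⟩
    CE.T a (ι (T b x))              ≈⟨ CE.T-cong a (ι-T b x) ⟩
    CE.T a (CE.T b (ι x))           ≈⟨ CE.T-cong a (CE.T-cong b ι-x) ⟩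
    CE.T a (CE.T b (z ⊕ w))         ≈⟨ CE.T-cong a (T-powers b) ⟩
    CE.T a ((z ^ᴱ b) ⊕ (w ^ᴱ b))    ≈⟨ CE.Inverses.T-powers (z^k*w^k≈1 b) a ⟩
    ((z ^ᴱ b) ^ᴱ a) ⊕ ((w ^ᴱ b) ^ᴱ a) ≈⟨ E.+-cong (^ᴱ-assocʳ z b a) (^ᴱ-assocʳ w b a) ⟩
    (z ^ᴱ (b ℕ.* a)) ⊕ (w ^ᴱ (b ℕ.* a)) ≈⟨ T-powers (b ℕ.* a) ⟨
    CE.T (b ℕ.* a) (z ⊕ w)          ≈⟨ CE.T-cong (b ℕ.* a) ι-x ⟨
    CE.T (b ℕ.* a) (ι x)            ≈⟨ ι-T (b ℕ.* a) x ⟨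
    ι (T (b ℕ.* a) x)               ∎)
    where
    open Q x
    open import Relation.Binary.Reasoning.Setoid E.setoid

  T-even : ∀ k x → let u = lucas 1# x x k in T (suc k ℕ.+ suc k) x - 2# ≈ (x * x - 2# * 2#) * (u * u)
  T-even k x = proj₁ (begin
    ι (T n x - 2#)                                 ≈⟨ ι-- (T n x) 2# ⟩
    ι (T n x) ⊕ (⊝ ι 2#)                           ≈⟨ E.+-cong (E.trans (ι-T n x) (CE.T-cong n ι-x)) (E.-‿cong ι-2) ⟩
    CE.T n (z ⊕ w) ⊕ (⊝ CE.2#)                     ≈⟨ U-square k ⟩
    ((z ⊕ w) ⊛ (z ⊕ w) ⊕ (⊝ (CE.2# ⊛ CE.2#))) ⊛ (u′ ⊛ u′)
      ≈⟨ E.*-cong (E.+-cong (E.*-cong ι-x ι-x) (E.-‿cong (E.*-cong ι-2 ι-2))) (E.*-cong ιu ιu) ⟨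
    (ι x ⊛ ι x ⊕ (⊝ (ι 2# ⊛ ι 2#))) ⊛ (ι u ⊛ ι u)
      ≈⟨ E.*-cong (E.+-cong (ι-* x x) (E.-‿cong (ι-* 2# 2#))) (ι-* u u) ⟨
    (ι (x * x) ⊕ (⊝ ι (2# * 2#))) ⊛ ι (u * u)      ≈⟨ E.*-congʳ (ι-- (x * x) (2# * 2#)) ⟨
    ι (x * x - 2# * 2#) ⊛ ι (u * u)                ≈⟨ ι-* (x * x - 2# * 2#) (u * u) ⟨
    ι ((x * x - 2# * 2#) * (u * u))                ∎)
    where
    open Q x
    open import Relation.Binary.Reasoning.Setoid E.setoid
    n = suc k ℕ.+ suc k
    u = lucas 1# x x k
    u′ = CE.lucas E.1# (z ⊕ w) (z ⊕ w) k
    ιu : ι u ≋ u′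
    ιu = E.trans (ι-lucas 1# x x k) (CE.lucas-cong E.refl ι-x ι-x k)

  T-odd : ∀ k x → let u = lucas 1# (x + 1#) x k in T (suc (k ℕ.+ k)) x - 2# ≈ (x - 2#) * (u * u)
  T-odd k x = proj₁ (begin
    ι (T n x - 2#)                                 ≈⟨ ι-- (T n x) 2# ⟩
    ι (T n x) ⊕ (⊝ ι 2#)                           ≈⟨ E.+-cong (E.trans (ι-T n x) (CE.T-cong n ι-x)) (E.-‿cong ι-2) ⟩
    CE.T n (z ⊕ w) ⊕ (⊝ CE.2#)                     ≈⟨ CE.W-square z⊛w≈1 k ⟩
    ((z ⊕ w) ⊕ (⊝ CE.2#)) ⊛ (u′ ⊛ u′)
      ≈⟨ E.*-cong (E.+-cong ι-x (E.-‿cong ι-2)) (E.*-cong ιu ιu) ⟨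
    (ι x ⊕ (⊝ ι 2#)) ⊛ (ι u ⊛ ι u)                 ≈⟨ E.*-cong (ι-- x 2#) (ι-* u u) ⟨
    ι (x - 2#) ⊛ ι (u * u)                         ≈⟨ ι-* (x - 2#) (u * u) ⟨
    ι ((x - 2#) * (u * u))                         ∎)
    where
    open Q x
    open import Relation.Binary.Reasoning.Setoid E.setoid
    n = suc (k ℕ.+ k)
    u = lucas 1# (x + 1#) x k
    u′ = CE.lucas E.1# ((z ⊕ w) ⊕ E.1#) (z ⊕ w) k
    ιu : ι u ≋ u′
    ιu = E.trans (ι-lucas 1# (x + 1#) x k)
      (CE.lucas-cong E.refl (E.trans (ι-+ x 1#) (E.+-congʳ ι-x)) ι-x k)

  -- z^p + w^p = (z + w)^p in the extension.
  T-frobenius : ∀ {p} → Prime p → p ×ᵤ 1# ≈ 0# → ∀ x → T p x ≈ x ^ p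
  T-frobenius {p} pp char x = proj₁ (begin
    ι (T p x)                 ≈⟨ E.trans (ι-T p x) (CE.T-cong p ι-x) ⟩
    CE.T p (z ⊕ w)            ≈⟨ T-powers p ⟩
    (z ^ᴱ p) ⊕ (w ^ᴱ p)       ≈⟨ Frobenius.frobenius-+ extension pp (E.trans (E.sym (ι-× p 1#)) (ι-cong char)) z w ⟨
    (z ⊕ w) ^ᴱ p              ≈⟨ ^ᴱ-congˡ p ι-x ⟨
    ι x ^ᴱ p                  ≈⟨ ι-^ x p ⟨
    ι (x ^ p)                 ∎)
    where
    open Q x
    open import Relation.Binary.Reasoning.Setoid E.setoid

  T-frobenius-^ : ∀ {p} → Prime p → p ×ᵤ 1# ≈ 0# → ∀ n x → T (p ℕ.^ n) x ≈ x ^ (p ℕ.^ n)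
  T-frobenius-^ pp char zero x = sym (*-identityʳ x)
  T-frobenius-^ {p} pp char (suc n) x = begin
    T (p ℕ.^ suc n) x        ≡⟨ ≡.cong (λ k → T k x) (ℕ.*-comm p (p ℕ.^ n)) ⟩
    T (p ℕ.^ n ℕ.* p) x      ≈⟨ T-∘ p (p ℕ.^ n) x ⟨
    T p (T (p ℕ.^ n) x)      ≈⟨ T-frobenius pp char (T (p ℕ.^ n) x) ⟩
    T (p ℕ.^ n) x ^ p        ≈⟨ ^-congˡ p (T-frobenius-^ pp char n x) ⟩
    (x ^ (p ℕ.^ n)) ^ p      ≈⟨ ^-assocʳ x (p ℕ.^ n) p ⟩
    x ^ (p ℕ.^ n ℕ.* p)      ≡⟨ ≡.cong (x ^_) (ℕ.*-comm (p ℕ.^ n) p) ⟩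
    x ^ (p ℕ.^ suc n)        ∎
    where open import Relation.Binary.Reasoning.Setoid setoid

-- Counting by filtered lists.

module FilterLength {a} {A : Set a} where
  open import Data.Nat.Base using (_+_; _≤_; z≤n; s≤s)
  open import Data.Nat.Properties

  length-filter-⊆ : ∀ {p q} {P : Pred A p} {Q : Pred A q} (P? : Unary.Decidable P) (Q? : Unary.Decidable Q) →
    (∀ x → P x → Q x) → ∀ xs → length (filter P? xs) ≤ length (filter Q? xs)
  length-filter-⊆ P? Q? P⊆Q [] = z≤n
  length-filter-⊆ P? Q? P⊆Q (x ∷ xs) with ih ← length-filter-⊆ P? Q? P⊆Q xs | P? x | Q? x
  ... | yes _ | yes _ = s≤s ih
  ... | yes p | no ¬q = contradiction (P⊆Q x p) ¬q
  ... | no _  | yes _ = m≤n⇒m≤1+n ih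
  ... | no _  | no _  = ih

  module _ {p q r} {P : Pred A p} {Q : Pred A q} {R : Pred A r}
           (P? : Unary.Decidable P) (Q? : Unary.Decidable Q) (R? : Unary.Decidable R) where

    length-filter-∪ : (∀ x → P x → Q x ⊎ R x) → ∀ xs →
      length (filter P? xs) ≤ length (filter Q? xs) + length (filter R? xs)
    length-filter-∪ P⊆Q∪R [] = z≤n
    length-filter-∪ P⊆Q∪R (x ∷ xs) with ih ← length-filter-∪ P⊆Q∪R xs | P? x | Q? x | R? x
    ... | no _  | yes _ | yes _ = m≤n⇒m≤1+n (≤-trans ih (+-monoʳ-≤ (length (filter Q? xs)) (n≤1+n _)))
    ... | no _  | yes _ | no _  = m≤n⇒m≤1+n ih
    ... | no _  | no _  | yes _ = ≤-trans ih (+-monoʳ-≤ (length (filter Q? xs)) (n≤1+n _))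
    ... | no _  | no _  | no _  = ih
    ... | yes _ | yes _ | yes _ = s≤s (≤-trans ih (+-monoʳ-≤ (length (filter Q? xs)) (n≤1+n _)))
    ... | yes _ | yes _ | no _  = s≤s ih
    ... | yes _ | no _  | yes _ = ≤-trans (s≤s ih) (≤-reflexive (≡.sym (+-suc (length (filter Q? xs)) _)))
    ... | yes p | no ¬q | no ¬r = contradiction (P⊆Q∪R x p) [ ¬q , ¬r ]′

    -- Half of inclusion-exclusion, with P around the union and S around the intersection.
    length-filter-∩ : ∀ {s} {S : Pred A s} (S? : Unary.Decidable S) →
      (∀ x → Q x → P x) → (∀ x → R x → P x) → (∀ x → Q x → R x → S x) → ∀ xs →
      length (filter Q? xs) + length (filter R? xs) ≤ length (filter P? xs) + length (filter S? xs)
    length-filter-∩ S? Q⊆P R⊆P Q∩R⊆S [] = z≤n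
    length-filter-∩ S? Q⊆P R⊆P Q∩R⊆S (x ∷ xs)
      with ih ← length-filter-∩ S? Q⊆P R⊆P Q∩R⊆S xs | P? x | Q? x | R? x | S? x
    ... | no ¬p | yes q | _     | _     = contradiction (Q⊆P x q) ¬p
    ... | no ¬p | no _  | yes r | _     = contradiction (R⊆P x r) ¬p
    ... | no _  | no _  | no _  | yes _ = ≤-trans ih (+-monoʳ-≤ (length (filter P? xs)) (n≤1+n _))
    ... | no _  | no _  | no _  | no _  = ih
    ... | yes _ | yes q | yes r | no ¬s = contradiction (Q∩R⊆S x q r) ¬s
    ... | yes _ | yes _ | yes _ | yes _ = s≤s (≤-trans (≤-reflexive (+-suc (length (filter Q? xs)) _))
      (≤-trans (s≤s ih) (≤-reflexive (≡.sym (+-suc (length (filter P? xs)) _)))))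
    ... | yes _ | yes _ | no _  | yes _ = s≤s (≤-trans ih (+-monoʳ-≤ (length (filter P? xs)) (n≤1+n _)))
    ... | yes _ | yes _ | no _  | no _  = s≤s ih
    ... | yes _ | no _  | yes _ | yes _ = ≤-trans (≤-reflexive (+-suc (length (filter Q? xs)) _))
      (s≤s (≤-trans ih (+-monoʳ-≤ (length (filter P? xs)) (n≤1+n _))))
    ... | yes _ | no _  | yes _ | no _  = ≤-trans (≤-reflexive (+-suc (length (filter Q? xs)) _)) (s≤s ih)
    ... | yes _ | no _  | no _  | yes _ = m≤n⇒m≤1+n (≤-trans ih (+-monoʳ-≤ (length (filter P? xs)) (n≤1+n _)))
    ... | yes _ | no _  | no _  | no _  = m≤n⇒m≤1+n ih

  length-cover : ∀ {q r} {Q : Pred A q} {R : Pred A r} (Q? : Unary.Decidable Q) (R? : Unary.Decidable R) →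
    (∀ x → Q x ⊎ R x) → ∀ xs → length xs ≤ length (filter Q? xs) + length (filter R? xs)
  length-cover Q? R? cover xs = ≤-trans
    (≤-reflexive (≡.cong length (≡.sym (filter-all U? (All.universal-U xs)))))
    (length-filter-∪ U? Q? R? (λ x _ → cover x) xs)
    where
    open import Relation.Unary.Properties using (U?)
    open import Data.List.Properties using (filter-all)
    import Data.List.Relation.Unary.All as All

-- IsPolynomial a d f: f agrees with a polynomial of formal degree d whose coefficient of degree d
-- is a. Exact divisibility of f x − f a by x − a is all that root counting uses.
module PolynomialFunctions {c ℓ} (R : CommutativeRing c ℓ) where
  open CommutativeRing R
  open Chebyshev R using (lucas)
  open IntegerCoefficients R
  open import Algebra.Properties.Semiring.Exp semiring using (_^_)
  open import Data.Integer.Base using (+_)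
  open import Relation.Binary.Reasoning.Setoid setoid

  IsPolynomial : Carrier → ℕ → (Carrier → Carrier) → Set (c ⊔ ℓ)
  IsPolynomial l zero    f = ∀ x → f x ≈ l
  IsPolynomial l (suc d) f = ∀ a → ∃[ g ] IsPolynomial l d g × (∀ x → f x - f a ≈ (x - a) * g x)

  -- The degree is formal and the top coefficient may vanish; this lets polynomials of different
  -- degrees be added.
  raise : ∀ {l} d {f} → IsPolynomial l d f → IsPolynomial 0# (suc d) f
  raise {l} zero {f} fp a = (λ _ → 0#) , (λ _ → refl) , λ x → begin
    f x - f a     ≈⟨ +-cong (fp x) (-‿cong (fp a)) ⟩
    l - l         ≈⟨ solve 3 (λ l x a → l :- l := (x :- a) :* con (+ 0)) refl l x a ⟩
    (x - a) * 0#  ∎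
  raise (suc d) fp a with g , gp , eq ← fp a = g , raise d gp , eq

  +-scaled : ∀ {l} d {f g} → IsPolynomial l d f → IsPolynomial 0# d g →
    ∀ s {h} → (∀ x → h x ≈ f x + s * g x) → IsPolynomial l d h
  +-scaled {l} zero {f} {g} fp gp s {h} h≈ x = begin
    h x             ≈⟨ h≈ x ⟩
    f x + s * g x   ≈⟨ +-cong (fp x) (*-congˡ (gp x)) ⟩
    l + s * 0#      ≈⟨ solve 2 (λ l s → l :+ s :* con (+ 0) := l) refl l s ⟩
    l               ∎
  +-scaled (suc d) {f} {g} fp gp s {h} h≈ a with f′ , fp′ , eqf ← fp a | g′ , gp′ , eqg ← gp a =
    (λ x → f′ x + s * g′ x) , +-scaled d fp′ gp′ s (λ _ → refl) , λ x → begin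
      h x - h a                                     ≈⟨ +-cong (h≈ x) (-‿cong (h≈ a)) ⟩
      (f x + s * g x) - (f a + s * g a)             ≈⟨ solve 5 (λ s u v u′ v′ →
        (u :+ s :* v) :- (u′ :+ s :* v′) := (u :- u′) :+ s :* (v :- v′)) refl s (f x) (g x) (f a) (g a) ⟩
      (f x - f a) + s * (g x - g a)                 ≈⟨ +-cong (eqf x) (*-congˡ (eqg x)) ⟩
      (x - a) * f′ x + s * ((x - a) * g′ x)         ≈⟨ solve 4 (λ y s u v →
        y :* u :+ s :* (y :* v) := y :* (u :+ s :* v)) refl (x - a) s (f′ x) (g′ x) ⟩
      (x - a) * (f′ x + s * g′ x)                   ∎

  x*-isPolynomial : ∀ {l} d {f} → IsPolynomial l d f → IsPolynomial l (suc d) (λ x → x * f x)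
  x*-isPolynomial {l} zero {f} fp a = (λ _ → l) , (λ _ → refl) , λ x → begin
    x * f x - a * f a   ≈⟨ +-cong (*-congˡ (fp x)) (-‿cong (*-congˡ (fp a))) ⟩
    x * l - a * l       ≈⟨ solve 3 (λ x a l → x :* l :- a :* l := (x :- a) :* l) refl x a l ⟩
    (x - a) * l         ∎
  x*-isPolynomial (suc d) {f} fp a with g , gp , eq ← fp a =
    (λ x → f x + a * g x) , +-scaled (suc d) fp (raise d gp) a (λ _ → refl) , λ x → begin
      x * f x - a * f a               ≈⟨ solve 4 (λ x a u v → x :* u :- a :* v := (x :- a) :* u :+ a :* (u :- v))
                                           refl x a (f x) (f a) ⟩
      (x - a) * f x + a * (f x - f a) ≈⟨ +-congˡ (*-congˡ (eq x)) ⟩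
      (x - a) * f x + a * ((x - a) * g x) ≈⟨ solve 4 (λ y a u v → y :* u :+ a :* (y :* v) := y :* (u :+ a :* v))
                                           refl (x - a) a (f x) (g x) ⟩
      (x - a) * (f x + a * g x)       ∎

  linear-isPolynomial : ∀ b → IsPolynomial 1# 1 (λ x → x + b)
  linear-isPolynomial b a = (λ _ → 1#) , (λ _ → refl) , λ x →
    solve 3 (λ x a b → (x :+ b) :- (a :+ b) := (x :- a) :* con (+ 1)) refl x a b

  id-isPolynomial : IsPolynomial 1# 1 id
  id-isPolynomial a = (λ _ → 1#) , (λ _ → refl) , λ x → sym (*-identityʳ (x - a))

  ^-isPolynomial : ∀ d → IsPolynomial 1# d (_^ d)
  ^-isPolynomial zero    _ = refl
  ^-isPolynomial (suc d)   = x*-isPolynomial d (^-isPolynomial d)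

  translate : ∀ {l} d {f} b → IsPolynomial l (suc d) f → IsPolynomial l (suc d) (λ x → f x - b)
  translate d {f} b fp a with g , gp , eq ← fp a = g , gp , λ x →
    trans (solve 3 (λ u v b → (u :- b) :- (v :- b) := u :- v) refl (f x) (f a) b) (eq x)

  -- Index 0 is left out because the starting value u need not be 1: T₀ = 2. The subtracted term has
  -- degree two below the new one, hence the double `raise`.
  lucas-isPolynomial : ∀ u {v} → IsPolynomial 1# 1 v → ∀ n →
    IsPolynomial 1# (suc n) (λ x → lucas u (v x) x (suc n))
  lucas-isPolynomial u {v} vp zero = vp
  lucas-isPolynomial u {v} vp (suc zero) =
    +-scaled 2 (x*-isPolynomial 1 vp) (raise 1 {λ _ → u} (raise 0 {λ _ → u} (λ _ → refl))) (- 1#)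
      (λ x → solve 3 (λ x u v → x :* v :- u := x :* v :+ (:- con (+ 1)) :* u) refl x u (v x))
  lucas-isPolynomial u {v} vp (suc (suc n)) =
    +-scaled (suc (suc (suc n))) (x*-isPolynomial (suc (suc n)) (lucas-isPolynomial u vp (suc n)))
      (raise (suc (suc n)) {h} (raise (suc n) {h} (lucas-isPolynomial u vp n))) (- 1#)
      (λ x → solve 3 (λ x u v → x :* v :- u := x :* v :+ (:- con (+ 1)) :* u) refl x
        (h x) (lucas u (v x) x (suc (suc n))))
    where
    h : Carrier → Carrier
    h x = lucas u (v x) x (suc n)

-- Finite fields: inverses, characteristic, Frobenius and root counting.

module FiniteFieldProperties {c ℓ₁ ℓ₂ k} (K : FiniteField c ℓ₁ ℓ₂ k) where
  open FiniteField K public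
  import Algebra.Properties.CommutativeMonoid.Sum as MonoidSum
  open import Algebra.Apartness.Bundles using (HeytingField)
  private module H = HeytingField heytingField
  open CommutativeRing commutativeRing public
  open ChebyshevProperties commutativeRing public
  open PolynomialFunctions commutativeRing public
  open import Algebra.Properties.Semiring.Exp semiring public using (_^_; ^-congˡ; ^-assocʳ)
  open import Algebra.Properties.Semiring.Mult semiring using (×1-homo-*) renaming (_×_ to _×ᵤ_)
  open import Algebra.Properties.Ring ring
  open import Function.Bundles using (Inverse; Injection)
  open import Function.Properties.Inverse using (Inverse⇒Injection)
  open Inverse enumeration using (to; from; to-cong; strictlyInverseˡ; strictlyInverseʳ)
  open import Data.Fin.Permutation using (Permutation′; permutation)
  open import Relation.Binary.Reasoning.Setoid setoid
  open import Data.List.Relation.Unary.All as All using (All; []; _∷_)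
  open import Data.List.Relation.Unary.Any as Any using (Any)
  import Data.List.Relation.Unary.All.Properties as All
  open import Data.List.Relation.Unary.Unique.Setoid setoid using (Unique; []; _∷_)
  import Data.List.Relation.Unary.Unique.Setoid.Properties as Unique
  open import Data.List.Membership.Setoid setoid using (_∈_)
  import Data.List.Membership.Setoid.Properties as Membership
  open import Data.List.Properties using (map-tabulate; length-tabulate)

  infix 4 _≟_
  _≟_ : ∀ x y → Dec (x ≈ y)
  _≟_ = via-injection (Inverse⇒Injection enumeration) Fin._≟_

  private
    module Product = MonoidSum *-commutativeMonoid

    x-0≈x : ∀ x → x - 0# ≈ x
    x-0≈x x = trans (+-congˡ -0#≈0#) (+-identityʳ x)

  1≉0 : ¬ 1# ≈ 0#
  1≉0 1≈0 = H.#-irrefl 1≈0 (H.invertible⇒#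
    (1# , trans (*-identityˡ _) (x-0≈x 1#) , trans (*-identityʳ _) (x-0≈x 1#)))

  -- A Heyting field inverts only what is apart from 0. Searching the finite field decides whether
  -- an inverse exists; if none does, x is not apart from 0, hence equal to 0 by tightness.
  inverse : ∀ {x} → ¬ x ≈ 0# → ∃[ y ] x * y ≈ 1#
  inverse {x} x≉0 with Fin.any? (λ i → x * from i ≟ 1#)
  ... | yes (i , eq) = from i , eq
  ... | no  none     = contradiction (proj₁ (H.tight x 0#) not-apart) x≉0
    where
    not-apart : ¬ x H.# 0#
    not-apart x#0 with y , _ , eq ← H.#⇒invertible x#0 = none (to y ,
      trans (*-cong (sym (x-0≈x x)) (strictlyInverseʳ y)) eq)

  *-integral : ∀ {x y} → x * y ≈ 0# → x ≈ 0# ⊎ y ≈ 0#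
  *-integral {x} {y} xy≈0 with x ≟ 0#
  ... | yes x≈0 = inj₁ x≈0
  ... | no  x≉0 with x⁻¹ , xx⁻¹≈1 ← inverse x≉0 = inj₂ (begin
    y                ≈⟨ *-identityˡ y ⟨
    1# * y           ≈⟨ *-congʳ xx⁻¹≈1 ⟨
    x * x⁻¹ * y      ≈⟨ *-congʳ (*-comm x x⁻¹) ⟩
    x⁻¹ * x * y      ≈⟨ *-assoc x⁻¹ x y ⟩
    x⁻¹ * (x * y)    ≈⟨ *-congˡ xy≈0 ⟩
    x⁻¹ * 0#         ≈⟨ zeroʳ x⁻¹ ⟩
    0#               ∎)

  square≈0⇒≈0 : ∀ {x} → x * x ≈ 0# → x ≈ 0#
  square≈0⇒≈0 eq = [ id , id ]′ (*-integral eq)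

  ^≈0⇒≈0 : ∀ {x} n → x ^ n ≈ 0# → x ≈ 0#
  ^≈0⇒≈0 zero    eq = contradiction eq 1≉0
  ^≈0⇒≈0 (suc n) eq = [ id , ^≈0⇒≈0 n ]′ (*-integral eq)

  -- Translation by 1 permutes K, so the sum of all elements is unchanged when k · 1 is added to it.
  order×1≈0 : k ×ᵤ 1# ≈ 0#
  order×1≈0 = begin
    k ×ᵤ 1#                          ≈⟨ +-identityˡ _ ⟨
    0# + k ×ᵤ 1#                     ≈⟨ +-congʳ (-‿inverseˡ total) ⟨
    (- total + total) + k ×ᵤ 1#      ≈⟨ +-assoc (- total) total (k ×ᵤ 1#) ⟩
    - total + (total + k ×ᵤ 1#)      ≈⟨ +-congˡ shifted ⟨
    - total + total                  ≈⟨ -‿inverseˡ total ⟩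
    0#                               ∎
    where
    open MonoidSum +-commutativeMonoid
    total : Carrier
    total = sum from
    shift : Permutation′ k
    shift = permutation (λ i → to (from i + 1#)) (λ i → to (from i - 1#))
      (λ i → ≡.trans (to-cong (trans (+-congʳ (strictlyInverseʳ _))
        (trans (+-assoc _ _ _) (trans (+-congˡ (-‿inverseˡ 1#)) (+-identityʳ _))))) (strictlyInverseˡ i))
      (λ i → ≡.trans (to-cong (trans (+-congʳ (strictlyInverseʳ _))
        (trans (+-assoc _ _ _) (trans (+-congˡ (-‿inverseʳ 1#)) (+-identityʳ _))))) (strictlyInverseˡ i))
    shifted : total ≈ total + k ×ᵤ 1#
    shifted = begin
      sum from                              ≈⟨ sum-permute from shift ⟩
      sum (λ i → from (to (from i + 1#)))   ≈⟨ sum-cong-≋ (λ i → strictlyInverseʳ (from i + 1#)) ⟩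
      sum (λ i → from i + 1#)               ≈⟨ ∑-distrib-+ from (λ _ → 1#) ⟩
      sum from + sum (λ (_ : Fin k) → 1#)   ≈⟨ +-congˡ (sum-replicate k) ⟩
      total + k ×ᵤ 1#                       ∎

  -- (p · 1)^n = p^n · 1 = 0, and a field has no nilpotents.
  characteristic : ∀ p n → p ℕ.^ n ≡ k → p ×ᵤ 1# ≈ 0#
  characteristic p n p^n≡k = ^≈0⇒≈0 n (trans (sym (power-×1 n)) (trans (reflexive (≡.cong (_×ᵤ 1#) p^n≡k)) order×1≈0))
    where
    power-×1 : ∀ n → (p ℕ.^ n) ×ᵤ 1# ≈ (p ×ᵤ 1#) ^ n
    power-×1 zero    = +-identityʳ 1#
    power-×1 (suc n) = trans (×1-homo-* p (p ℕ.^ n)) (*-congˡ (power-×1 n))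

  product≈0⇒factor≈0 : ∀ {n} (f : Fin n → Carrier) →
    Product.sum f ≈ 0# → ∃[ i ] f i ≈ 0#
  product≈0⇒factor≈0 {zero}  f eq = contradiction eq 1≉0
  product≈0⇒factor≈0 {suc n} f eq with *-integral eq
  ... | inj₁ f0≈0 = Fin.zero , f0≈0
  ... | inj₂ eq′ with i , fi≈0 ← product≈0⇒factor≈0 (f ∘ Fin.suc) eq′ = Fin.suc i , fi≈0

  -- Multiplication by x permutes the nonzero elements, so x^k′ leaves their product unchanged.
  unit^≈1 : ∀ {k′} → suc k′ ≡ k → ∀ {x} → ¬ x ≈ 0# → x ^ k′ ≈ 1#
  unit^≈1 {k′} ≡.refl {x} x≉0 with x⁻¹ , xx⁻¹≈1 ← inverse x≉0 =
    [ (λ eq → x-y≈0⇒x≈y (trans (+-congʳ (sym factors≈x^)) eq))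
    , (λ eq → let i , nz≈0 = product≈0⇒factor≈0 (nz ∘ from) eq in contradiction nz≈0 (nz≉0 (from i)))
    ]′ (*-integral {product factor - 1#} {total} (begin
      (product factor - 1#) * total         ≈⟨ distribʳ total (product factor) (- 1#) ⟩
      product factor * total + - 1# * total ≈⟨ +-cong (sym permuted) (-1*x≈-x total) ⟩
      total - total                         ≈⟨ -‿inverseʳ total ⟩
      0#                                    ∎))
    where
    open Product renaming (sum to product; sum-permute to product-permute; sum-cong-≋ to product-cong;
        ∑-distrib-+ to ∏-distrib-*; sum-remove to product-remove; sum-replicate to product-replicate)
    nz : Carrier → Carrier
    nz y with y ≟ 0#
    ... | yes _ = 1#
    ... | no  _ = y
    nz≉0 : ∀ y → ¬ nz y ≈ 0#
    nz≉0 y with y ≟ 0#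
    ... | yes _   = 1≉0
    ... | no  y≉0 = y≉0
    total : Carrier
    total = product (nz ∘ from)
    -- At the index of 0 the factor is 1, since `nz` replaces 0 by 1 both before and after scaling;
    -- k - 1 factors x remain.
    factor : Fin k → Carrier
    factor i with from i ≟ 0#
    ... | yes _ = 1#
    ... | no  _ = x
    inverse-* : ∀ {u v} → u * v ≈ 1# → ∀ i → to (u * from (to (v * from i))) ≡ i
    inverse-* {u} {v} uv≈1 i = ≡.trans (to-cong (trans (*-congˡ (strictlyInverseʳ _))
      (trans (sym (*-assoc u v (from i))) (trans (*-congʳ uv≈1) (*-identityˡ _))))) (strictlyInverseˡ i)
    scale : Permutation′ k
    scale = permutation (λ i → to (x * from i)) (λ i → to (x⁻¹ * from i))
      (inverse-* xx⁻¹≈1) (inverse-* (trans (*-comm x⁻¹ x) xx⁻¹≈1))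
    nz-scale : ∀ i → nz (from (to (x * from i))) ≈ factor i * nz (from i)
    nz-scale i with from (to (x * from i)) ≟ 0# | from i ≟ 0#
    ... | yes _   | yes _   = sym (*-identityˡ 1#)
    ... | yes e≈0 | no y≉0  = contradiction (*-integral (trans (sym (strictlyInverseʳ _)) e≈0)) [ x≉0 , y≉0 ]′
    ... | no e≉0  | yes y≈0 = contradiction (trans (strictlyInverseʳ _) (trans (*-congˡ y≈0) (zeroʳ x))) e≉0
    ... | no _    | no _    = strictlyInverseʳ (x * from i)
    permuted : total ≈ product factor * total
    permuted = begin
      total                                           ≈⟨ product-permute (nz ∘ from) scale ⟩
      product (λ i → nz (from (to (x * from i))))     ≈⟨ product-cong nz-scale ⟩
      product (λ i → factor i * nz (from i))          ≈⟨ ∏-distrib-* factor (nz ∘ from) ⟩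
      product factor * total                          ∎
    i₀ : Fin k
    i₀ = to 0#
    factor-i₀ : factor i₀ ≈ 1#
    factor-i₀ with from i₀ ≟ 0#
    ... | yes _  = refl
    ... | no  ≉0 = contradiction (strictlyInverseʳ 0#) ≉0
    factor-other : ∀ j → factor (Fin.punchIn i₀ j) ≈ x
    factor-other j with from (Fin.punchIn i₀ j) ≟ 0#
    ... | yes ≈0 = contradiction (≡.trans (≡.sym (strictlyInverseˡ _)) (to-cong ≈0)) (Fin.punchInᵢ≢i i₀ j)
    ... | no  _  = refl
    factors≈x^ : product factor ≈ x ^ k′
    factors≈x^ = begin
      product factor                                          ≈⟨ product-remove {i = i₀} factor ⟩
      factor i₀ * product (λ j → factor (Fin.punchIn i₀ j))   ≈⟨ *-cong factor-i₀ (product-cong factor-other) ⟩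
      1# * product (λ (_ : Fin k′) → x)                       ≈⟨ *-identityˡ _ ⟩
      product (λ (_ : Fin k′) → x)                            ≈⟨ product-replicate k′ ⟩
      x ^ k′                                                  ∎

  ^order≈id : ∀ x → x ^ k ≈ x
  ^order≈id x = go k ≡.refl
    where
    go : ∀ k₁ → k₁ ≡ k → x ^ k₁ ≈ x
    go zero    eq = contradiction (≡.subst Fin (≡.sym eq) (to 0#)) λ ()
    go (suc k′) eq with x ≟ 0#
    ... | yes x≈0 = trans (*-congʳ x≈0) (trans (zeroˡ _) (sym x≈0))
    ... | no  x≉0 = trans (*-congˡ (unit^≈1 eq x≉0)) (*-identityʳ x)

  elements : List Carrier
  elements = map from (allFin k)

  private
    elements≡tabulate : elements ≡ Data.List.Base.tabulate from
    elements≡tabulate = map-tabulate id from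

  length-elements : length elements ≡ k
  length-elements = ≡.trans (≡.cong length elements≡tabulate) (length-tabulate from)

  elements-unique : Unique elements
  elements-unique = ≡.subst Unique (≡.sym elements≡tabulate) (Unique.tabulate⁺ setoid
    (λ eq → ≡.trans (≡.sym (strictlyInverseˡ _)) (≡.trans (to-cong eq) (strictlyInverseˡ _))))

  ∈-elements : ∀ x → x ∈ elements
  ∈-elements x = ≡.subst (x ∈_) (≡.sym elements≡tabulate)
    (Membership.∈-resp-≈ setoid (strictlyInverseʳ x) (Membership.∈-tabulate⁺ setoid (to x)))

  -- After division by x - a the other roots are roots of the quotient, which stays monic; in degree
  -- 0 it is the constant 1 and has none.
  roots-bound : ∀ d {f} → IsPolynomial 1# d f → ∀ xs → Unique xs → All (λ x → f x ≈ 0#) xs →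
    length xs ℕ.≤ d
  roots-bound d       fp [] _ _ = ℕ.z≤n
  roots-bound zero    fp (x ∷ _) _ (fx≈0 ∷ _) = contradiction (trans (sym (fp x)) fx≈0) 1≉0
  roots-bound (suc d) {f} fp (a ∷ xs) (a∉xs ∷ xs!) (fa≈0 ∷ fxs≈0) with g , gp , eq ← fp a =
    ℕ.s≤s (roots-bound d gp xs xs! (All.zipWith root (a∉xs , fxs≈0)))
    where
    root : ∀ {x} → (¬ a ≈ x) × f x ≈ 0# → g x ≈ 0#
    root {x} (a≉x , fx≈0) =
      [ (λ x-a≈0 → contradiction (sym (x-y≈0⇒x≈y x-a≈0)) a≉x) , id ]′ (*-integral (begin
        (x - a) * g x   ≈⟨ eq x ⟨
        f x - f a       ≈⟨ +-cong fx≈0 (-‿cong fa≈0) ⟩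
        0# - 0#         ≈⟨ -‿inverseʳ 0# ⟩
        0#              ∎))

  -- The fibre over each y consists of roots of f - y, which is still monic of the same degree.
  fibres-bound : ∀ d {f} → IsPolynomial 1# (suc d) f → ∀ ys xs → Unique xs →
    All (λ x → Any (λ y → f x ≈ y) ys) xs → length xs ℕ.≤ length ys ℕ.* suc d
  fibres-bound d fp [] []      _ _        = ℕ.z≤n
  fibres-bound d fp [] (x ∷ _) _ (() ∷ _)
  fibres-bound d {f} fp (y ∷ ys) xs xs! covered = ℕ.≤-trans
    (FilterLength.length-cover over? (¬? ∘ over?) (λ x → decide (over? x)) xs)
    (ℕ.+-mono-≤
      (roots-bound (suc d) (translate d y fp) (filter over? xs) (Unique.filter⁺ setoid over? xs!)
        (All.map x≈y⇒x-y≈0 (All.all-filter over? xs)))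
      (fibres-bound d fp ys (filter (¬? ∘ over?) xs) (Unique.filter⁺ setoid (¬? ∘ over?) xs!)
        (All.zipWith (λ (not-over , c) → Any.tail not-over c)
          (All.all-filter (¬? ∘ over?) xs , All.filter⁺ (¬? ∘ over?) covered))))
    where
    over? : ∀ x → Dec (f x ≈ y)
    over? x = f x ≟ y
    decide : ∀ {a} {A : Set a} → Dec A → A ⊎ ¬ A
    decide (yes p) = inj₁ p
    decide (no ¬p) = inj₂ ¬p

  #_ : ∀ {p} {P : Pred Carrier p} → Unary.Decidable P → ℕ
  # P? = length (filter P? elements)

  #-roots : ∀ d {f} → IsPolynomial 1# d f → ∀ {p} {P : Pred Carrier p} (P? : Unary.Decidable P) →
    (∀ x → P x → f x ≈ 0#) → # P? ℕ.≤ d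
  #-roots d fp P? P⊆root = roots-bound d fp _ (Unique.filter⁺ setoid P? elements-unique)
    (All.map (λ {x} → P⊆root x) (All.all-filter P? elements))

  #-singleton : ∀ y → # (_≟ y) ℕ.≤ 1
  #-singleton y = #-roots 1 (linear-isPolynomial (- y)) (_≟ y) (λ _ → x≈y⇒x-y≈0)

  #-fibres : ∀ d .{{_ : ℕ.NonZero d}} {f} → IsPolynomial 1# d f →
    ∀ {p q} {P : Pred Carrier p} {Q : Pred Carrier q} (P? : Unary.Decidable P) (Q? : Unary.Decidable Q) →
    Q Respects _≈_ → (∀ x → P x → Q (f x)) → # P? ℕ.≤ # Q? ℕ.* d
  #-fibres (suc d) {f} fp P? Q? resp P⊆Q = fibres-bound d fp (filter Q? elements) (filter P? elements)
    (Unique.filter⁺ setoid P? elements-unique)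
    (All.map (λ {x} Px → Membership.∈-filter⁺ setoid Q? resp (∈-elements (f x)) (P⊆Q x Px))
      (All.all-filter P? elements))

parity : ∀ n → ∃[ k ] (n ≡ k ℕ.+ k ⊎ n ≡ suc (k ℕ.+ k))
parity zero = 0 , inj₁ ≡.refl
parity (suc n) with parity n
... | k , inj₁ eq = k , inj₂ (≡.cong suc eq)
... | k , inj₂ eq = suc k , inj₁ (≡.cong suc (≡.trans eq (≡.sym (ℕ.+-suc k k))))

-- What the families xⁿ (with neutral = 1) and Tₙ (with neutral = 2) have in common.
record PowerLike {c ℓ} (R : CommutativeRing c ℓ) : Set (c ⊔ ℓ) where
  open CommutativeRing R
  open PolynomialFunctions R using (IsPolynomial)
  field
    g               : ℕ → Carrier → Carrier
    neutral         : Carrier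
    g-cong          : ∀ n {x y} → x ≈ y → g n x ≈ g n y
    g-∘             : ∀ a b x → g a (g b x) ≈ g (b ℕ.* a) x
    g-1             : ∀ x → g 1 x ≈ x
    g-neutral       : ∀ n → g n neutral ≈ neutral
    g-return        : ∀ n x → g n x ≈ neutral → g (suc n) x ≈ x
    g-isPolynomial  : ∀ n .{{_ : ℕ.NonZero n}} → IsPolynomial 1# n (g n)

Represents : ∀ {c ℓ} (R : CommutativeRing c ℓ) → Poly → (CommutativeRing.Carrier R → CommutativeRing.Carrier R) → Set (c ⊔ ℓ)
Represents R φ f = ∀ x → Evaluation.eval R φ x ≈ f x
  where open CommutativeRing R using (_≈_)

-- Periodic points and torsion, for both families at once.

module PeriodicPoints {c ℓ₁ ℓ₂ k} (K : FiniteField c ℓ₁ ℓ₂ k)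
  (𝓕 : PowerLike (FiniteField.commutativeRing K))
  {q} (qp : Prime q) (φ : Poly)
  (φ≈g : Represents (FiniteField.commutativeRing K) φ (PowerLike.g 𝓕 q))
  where
  open FiniteFieldProperties K
  open PowerLike 𝓕
  open Periodic K φ public using (Per; per?)
  open Evaluation commutativeRing using (eval; eval-cong)
  import Function.Endo.Propositional as Endo
  open Endo Carrier using () renaming (_^_ to _^∘_)
  open import Relation.Binary.Reasoning.Setoid setoid

  private instance
    q≢0 : ℕ.NonZero q
    q≢0 = prime⇒nonZero qp

  -- The sets A_n of the overview; for the power family, the n-th roots of unity.
  Torsion : ℕ → Pred Carrier ℓ₁
  Torsion n x = g n x ≈ neutral

  torsion? : ∀ n → Unary.Decidable (Torsion n)
  torsion? n x = g n x ≟ neutral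

  iterate : ∀ m x → (eval φ ^∘ m) x ≈ g (q ℕ.^ m) x
  iterate zero    x = sym (g-1 x)
  iterate (suc m) x = begin
    eval φ ((eval φ ^∘ m) x)   ≈⟨ eval-cong φ (iterate m x) ⟩
    eval φ (g (q ℕ.^ m) x)     ≈⟨ φ≈g (g (q ℕ.^ m) x) ⟩
    g q (g (q ℕ.^ m) x)        ≈⟨ g-∘ q (q ℕ.^ m) x ⟩
    g (q ℕ.^ m ℕ.* q) x        ≡⟨ ≡.cong (λ n → g n x) (ℕ.*-comm (q ℕ.^ m) q) ⟩
    g (q ℕ.* q ℕ.^ m) x        ∎

  torsion-* : ∀ n j x → Torsion n x → Torsion (n ℕ.* j) x
  torsion-* n j x tors = begin
    g (n ℕ.* j) x   ≈⟨ g-∘ j n x ⟨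
    g j (g n x)     ≈⟨ g-cong j tors ⟩
    g j neutral     ≈⟨ g-neutral j ⟩
    neutral         ∎

  ∤⇒>0 : ∀ {n} → q ∤ n → 0 ℕ.< n
  ∤⇒>0 q∤n = ℕ.n≢0⇒n>0 λ { ≡.refl → q∤n (q ∣0) }

  -- As q is prime to n, some q^m is 1 + n j, and an index that is 1 modulo n fixes n-torsion.
  torsion⇒per : ∀ {n} → q ∤ n → ∀ x → Torsion n x → Per x
  torsion⇒per {n} q∤n x tors with m , 0<m , j , q^m≡ ← Arithmetic.power≡1 q n (∤⇒>0 q∤n) (Arithmetic.∤⇒coprime qp q∤n) =
    m , 0<m , (begin
      (eval φ ^∘ m) x         ≈⟨ iterate m x ⟩
      g (q ℕ.^ m) x           ≡⟨ ≡.cong (λ n → g n x) q^m≡ ⟩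
      g (suc (n ℕ.* j)) x     ≈⟨ g-return (n ℕ.* j) x (torsion-* n j x tors) ⟩
      x                       ∎)
  per⇒fixed-by-power : ∀ {m x} → g (q ℕ.^ m) x ≈ x → ∀ i → g (q ℕ.^ (m ℕ.* i)) x ≈ x
  per⇒fixed-by-power {m} {x} fixed zero    = trans (reflexive (≡.cong (λ n → g (q ℕ.^ n) x) (ℕ.*-zeroʳ m))) (g-1 x)
  per⇒fixed-by-power {m} {x} fixed (suc i) = begin
    g (q ℕ.^ (m ℕ.* suc i)) x             ≡⟨ ≡.cong (λ n → g (q ℕ.^ n) x) (ℕ.*-suc m i) ⟩
    g (q ℕ.^ (m ℕ.+ m ℕ.* i)) x           ≡⟨ ≡.cong (λ n → g n x) (ℕ.^-distribˡ-+-* q m (m ℕ.* i)) ⟩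
    g (q ℕ.^ m ℕ.* q ℕ.^ (m ℕ.* i)) x     ≈⟨ g-∘ (q ℕ.^ (m ℕ.* i)) (q ℕ.^ m) x ⟨
    g (q ℕ.^ (m ℕ.* i)) (g (q ℕ.^ m) x)   ≈⟨ g-cong (q ℕ.^ (m ℕ.* i)) fixed ⟩
    g (q ℕ.^ (m ℕ.* i)) x                 ≈⟨ per⇒fixed-by-power {m} fixed i ⟩
    x                                     ∎

  -- Going e times round a period m > 0 gives x = g_i(x) with i = q^(m e). As m e ≥ e, the index i n
  -- is a multiple of q^e n, so g_n(x) = g_(i n)(x) is neutral.
  per⇒torsion : ∀ e n x → Per x → Torsion (q ℕ.^ e ℕ.* n) x → Torsion n x
  per⇒torsion e n x (m , 0<m , per) tors = begin
    g n x                                 ≈⟨ g-cong n (per⇒fixed-by-power {m} (trans (sym (iterate m x)) per) e) ⟨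
    g n (g (q ℕ.^ (m ℕ.* e)) x)           ≈⟨ g-∘ n (q ℕ.^ (m ℕ.* e)) x ⟩
    g (q ℕ.^ (m ℕ.* e) ℕ.* n) x           ≡⟨ ≡.cong (λ n → g n x) rearranged ⟩
    g (q ℕ.^ e ℕ.* n ℕ.* q ℕ.^ r) x       ≈⟨ torsion-* (q ℕ.^ e ℕ.* n) (q ℕ.^ r) x tors ⟩
    neutral                               ∎
    where
    r = m ℕ.* e ℕ.∸ e
    rearranged : q ℕ.^ (m ℕ.* e) ℕ.* n ≡ q ℕ.^ e ℕ.* n ℕ.* q ℕ.^ r
    rearranged = ≡.trans
      (≡.cong (λ i → q ℕ.^ i ℕ.* n) (≡.sym (ℕ.m+[n∸m]≡n (ℕ.m≤n*m e m {{ℕ.>-nonZero 0<m}}))))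
      (≡.trans (≡.cong (ℕ._* n) (ℕ.^-distribˡ-+-* q e r))
        (≡.trans (ℕ.*-assoc (q ℕ.^ e) (q ℕ.^ r) n)
          (≡.trans (≡.cong (q ℕ.^ e ℕ.*_) (ℕ.*-comm (q ℕ.^ r) n)) (≡.sym (ℕ.*-assoc (q ℕ.^ e) n (q ℕ.^ r))))))

  #-torsion-fibres : ∀ e n → # torsion? (q ℕ.^ e ℕ.* n) ℕ.≤ # torsion? n ℕ.* q ℕ.^ e
  #-torsion-fibres e n = #-fibres (q ℕ.^ e) {{ℕ.m^n≢0 q e}} (g-isPolynomial (q ℕ.^ e) {{ℕ.m^n≢0 q e}})
    (torsion? (q ℕ.^ e ℕ.* n)) (torsion? n) (λ x≈y tors → trans (g-cong n (sym x≈y)) tors)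
    (λ x tors → trans (g-∘ n (q ℕ.^ e) x) tors)

-- Counting for z^q.

module PowerMap {c ℓ₁ ℓ₂ k} (K : FiniteField c ℓ₁ ℓ₂ k) {q} (qp : Prime q) where
  open FiniteFieldProperties K

  powers : PowerLike commutativeRing
  powers = record
    { g              = λ n x → x ^ n
    ; neutral        = 1#
    ; g-cong         = ^-congˡ
    ; g-∘            = λ a b x → ^-assocʳ x b a
    ; g-1            = *-identityʳ
    ; g-neutral      = 1^n≈1
    ; g-return       = λ n x x^n≈1 → trans (*-congˡ x^n≈1) (*-identityʳ x)
    ; g-isPolynomial = λ n → ^-isPolynomial n
    }
    where
    1^n≈1 : ∀ n → 1# ^ n ≈ 1#
    1^n≈1 zero    = refl
    1^n≈1 (suc n) = trans (*-identityˡ (1# ^ n)) (1^n≈1 n)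

  open PeriodicPoints K powers qp (power q) (eval-power q)

  zero-or-torsion : ∀ {k′} → suc k′ ≡ k → ∀ x → x ≈ 0# ⊎ Torsion k′ x
  zero-or-torsion eq x with x ≟ 0#
  ... | yes x≈0 = inj₁ x≈0
  ... | no  x≉0 = inj₂ (unit^≈1 eq x≉0)

  #-torsion : ∀ n → q ∤ n → # torsion? n ℕ.≤ n
  #-torsion zero    q∤n = contradiction (q ∣0) q∤n
  #-torsion (suc n) _   = #-roots (suc n) (translate n 1# (^-isPolynomial (suc n))) (torsion? (suc n))
    (λ _ → x≈y⇒x-y≈0)

  -- Both errors come from the point 0: the upper bound counts it among the periodic points, where
  -- it costs q^e, and the lower bound absorbs it through 1 ≤ q^e. The form `1 ℕ.* k` matches the
  -- numerator of the limit.
  #Per-power : ∀ e n → q ∤ n → suc (q ℕ.^ e ℕ.* n) ≡ k → let open Periodic K (power q) in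
    #Per ℕ.* q ℕ.^ e ℕ.≤ 1 ℕ.* k ℕ.+ q ℕ.^ e × 1 ℕ.* k ℕ.≤ #Per ℕ.* q ℕ.^ e ℕ.+ q ℕ.^ e
  #Per-power e n q∤n ≡.refl = upper , lower
    where
    open ℕ.≤-Reasoning
    E = q ℕ.^ e
    per = Periodic.#Per K (power q)
    1≤E : 1 ℕ.≤ E
    1≤E = ℕ.m^n>0 q {{prime⇒nonZero qp}} e

    per≤ : per ℕ.≤ 1 ℕ.+ n
    per≤ = ℕ.≤-trans
      (FilterLength.length-filter-∪ per? (_≟ 0#) (torsion? n)
        (λ x px → Sum.map id (per⇒torsion e n x px) (zero-or-torsion ≡.refl x)) elements)
      (ℕ.+-mono-≤ (#-singleton 0#) (#-torsion n q∤n))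

    torsion≤ : # torsion? n ℕ.≤ per
    torsion≤ = FilterLength.length-filter-⊆ (torsion? n) per? (torsion⇒per q∤n) elements

    upper : per ℕ.* E ℕ.≤ 1 ℕ.* k ℕ.+ E
    upper = begin
      per ℕ.* E                         ≤⟨ ℕ.*-monoˡ-≤ E per≤ ⟩
      E ℕ.+ n ℕ.* E                     ≡⟨ ≡.cong (E ℕ.+_) (ℕ.*-comm n E) ⟩
      E ℕ.+ E ℕ.* n                     ≡⟨ ℕ.+-comm E (E ℕ.* n) ⟩
      E ℕ.* n ℕ.+ E                     ≤⟨ ℕ.+-monoˡ-≤ E (ℕ.≤-trans (ℕ.n≤1+n (E ℕ.* n)) (ℕ.≤-reflexive (≡.sym (ℕ.*-identityˡ k)))) ⟩
      1 ℕ.* k ℕ.+ E                     ∎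

    lower : 1 ℕ.* k ℕ.≤ per ℕ.* E ℕ.+ E
    lower = begin
      1 ℕ.* k                                   ≡⟨ ℕ.*-identityˡ k ⟩
      k                                         ≡⟨ length-elements ⟨
      length elements                           ≤⟨ FilterLength.length-cover (_≟ 0#) (torsion? (E ℕ.* n)) (zero-or-torsion ≡.refl) elements ⟩
      # (_≟ 0#) ℕ.+ # torsion? (E ℕ.* n)        ≤⟨ ℕ.+-mono-≤ (ℕ.≤-trans (#-singleton 0#) 1≤E) (#-torsion-fibres e n) ⟩
      E ℕ.+ # torsion? n ℕ.* E                  ≤⟨ ℕ.+-monoʳ-≤ E (ℕ.*-monoˡ-≤ E torsion≤) ⟩
      E ℕ.+ per ℕ.* E                           ≡⟨ ℕ.+-comm E (per ℕ.* E) ⟩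
      per ℕ.* E ℕ.+ E                           ∎

-- Inequalities behind the Chebyshev count.

module ChebyshevCount where
  open import Data.Nat.Base
  open import Data.Nat.Properties
  open import Data.Nat.Tactic.RingSolver using (solve-∀)
  open ≤-Reasoning

  -- E = qᵉ, and a, b, b′ count the n′-, En- and n-torsion.
  count-bounds : ∀ {E n n′ Q a b b′ per} → 1 ≤ E → E * n + n′ ≡ Q + Q → E * n ≤ Q + 1 → n′ ≤ Q + 1 →
    2 * a ≤ n′ + 2 → 2 * b ≤ E * n + 2 → 2 * b′ ≤ n + 2 → b ≤ b′ * E → Q ≤ a + b →
    per ≤ a + b′ → a + b′ ≤ per + 2 →
    per * (2 * E) ≤ (E + 1) * Q + 10 * E × (E + 1) * Q ≤ per * (2 * E) + 10 * E
  count-bounds {E} {n} {n′} {Q} {a} {b} {b′} {per} 1≤E sum≡ N≤ n′≤ 2a≤ 2b≤ 2b′≤ b≤ Q≤ per≤ ≤per = upper , lower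
    where
    upper : per * (2 * E) ≤ (E + 1) * Q + 10 * E
    upper = begin
      per * (2 * E)                         ≤⟨ *-monoˡ-≤ (2 * E) per≤ ⟩
      (a + b′) * (2 * E)                    ≡⟨ expand a b′ E ⟩
      E * (2 * a) + E * (2 * b′)            ≤⟨ +-mono-≤ (*-monoʳ-≤ E 2a≤) (*-monoʳ-≤ E 2b′≤) ⟩
      E * (n′ + 2) + E * (n + 2)            ≡⟨ regroup E n n′ ⟩
      (E * n′ + E * n) + 4 * E              ≤⟨ +-monoˡ-≤ (4 * E) (+-mono-≤ (*-monoʳ-≤ E n′≤) N≤) ⟩
      (E * (Q + 1) + (Q + 1)) + 4 * E       ≡⟨ collect E Q ⟩
      (E + 1) * Q + (5 * E + 1)             ≤⟨ +-monoʳ-≤ ((E + 1) * Q) (+-monoʳ-≤ (5 * E) (≤-trans 1≤E (m≤n*m E 5))) ⟩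
      (E + 1) * Q + (5 * E + 5 * E)         ≡⟨ cong (λ z → (E + 1) * Q + z) (double E) ⟩
      (E + 1) * Q + 10 * E                  ∎
      where
      open ≡ using (cong)
      expand : ∀ a b′ E → (a + b′) * (2 * E) ≡ E * (2 * a) + E * (2 * b′)
      expand = solve-∀
      regroup : ∀ E n n′ → E * (n′ + 2) + E * (n + 2) ≡ (E * n′ + E * n) + 4 * E
      regroup = solve-∀
      collect : ∀ E Q → (E * (Q + 1) + (Q + 1)) + 4 * E ≡ (E + 1) * Q + (5 * E + 1)
      collect = solve-∀
      double : ∀ E → 5 * E + 5 * E ≡ 10 * E
      double = solve-∀

    2Q≤ : Q + Q ≤ 2 * a + 2 * b
    2Q≤ = begin
      Q + Q               ≤⟨ +-mono-≤ Q≤ Q≤ ⟩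
      (a + b) + (a + b)   ≡⟨ double a b ⟩
      2 * a + 2 * b       ∎
      where
      double : ∀ a b → (a + b) + (a + b) ≡ 2 * a + 2 * b
      double = solve-∀

    -- The upper bound 2b ≤ Q + 3 turns the cover into a lower bound for a; the next inequality
    -- exchanges the roles of a and b.
    Q≤2a+3 : Q ≤ 2 * a + 3
    Q≤2a+3 = +-cancelʳ-≤ Q Q (2 * a + 3) (begin
      Q + Q                   ≤⟨ 2Q≤ ⟩
      2 * a + 2 * b           ≤⟨ +-monoʳ-≤ (2 * a) (≤-trans 2b≤ (+-monoˡ-≤ 2 N≤)) ⟩
      2 * a + ((Q + 1) + 2)   ≡⟨ collect (2 * a) Q ⟩
      (2 * a + 3) + Q         ∎)
      where
      collect : ∀ x Q → x + ((Q + 1) + 2) ≡ (x + 3) + Q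
      collect = solve-∀

    Q≤2b+3 : Q ≤ 2 * b + 3
    Q≤2b+3 = +-cancelʳ-≤ Q Q (2 * b + 3) (begin
      Q + Q                   ≤⟨ 2Q≤ ⟩
      2 * a + 2 * b           ≤⟨ +-monoˡ-≤ (2 * b) (≤-trans 2a≤ (+-monoˡ-≤ 2 n′≤)) ⟩
      ((Q + 1) + 2) + 2 * b   ≡⟨ collect (2 * b) Q ⟩
      (2 * b + 3) + Q         ∎)
      where
      collect : ∀ x Q → ((Q + 1) + 2) + x ≡ (x + 3) + Q
      collect = solve-∀

    -- Here 10 E is used up: 3 E for a, 3 ≤ 3 E for b, and 4 E for the two points that the sets may
    -- share.
    lower : (E + 1) * Q ≤ per * (2 * E) + 10 * E
    lower = begin
      (E + 1) * Q                                ≡⟨ split E Q ⟩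
      E * Q + Q                                  ≤⟨ +-mono-≤ (*-monoʳ-≤ E Q≤2a+3) (≤-trans Q≤2b+3 (+-monoˡ-≤ 3 (*-monoʳ-≤ 2 b≤))) ⟩
      E * (2 * a + 3) + (2 * (b′ * E) + 3)       ≡⟨ regroup E a b′ ⟩
      (a + b′) * (2 * E) + 3 * E + 3 * 1         ≤⟨ +-mono-≤ (+-monoˡ-≤ (3 * E) (*-monoˡ-≤ (2 * E) ≤per)) (*-monoʳ-≤ 3 1≤E) ⟩
      (per + 2) * (2 * E) + 3 * E + 3 * E        ≡⟨ collect per E ⟩
      per * (2 * E) + 10 * E                     ∎
      where
      split : ∀ E Q → (E + 1) * Q ≡ E * Q + Q
      split = solve-∀
      regroup : ∀ E a b′ → E * (2 * a + 3) + (2 * (b′ * E) + 3) ≡ (a + b′) * (2 * E) + 3 * E + 3 * 1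
      regroup = solve-∀
      collect : ∀ per E → (per + 2) * (2 * E) + 3 * E + 3 * E ≡ per * (2 * E) + 10 * E
      collect = solve-∀

-- Counting for the Chebyshev polynomial.

module ChebyshevMap {c ℓ₁ ℓ₂ p n} (pp : Prime p) (K : FiniteField c ℓ₁ ℓ₂ (p ℕ.^ n)) {q} (qp : Prime q) where
  open FiniteFieldProperties K
  open import Data.Integer.Base using (+_)
  open IntegerCoefficients commutativeRing using (solve; _:=_; _:+_; _:*_; _:-_; :-_; con)
  open import Relation.Binary.Reasoning.Setoid setoid

  T-isPolynomial : ∀ n .{{_ : ℕ.NonZero n}} → IsPolynomial 1# n (T n)
  T-isPolynomial (suc n) = lucas-isPolynomial 2# id-isPolynomial n

  -- A vanishing factor in `T-product` makes the square of T_{m+1}(x) - x zero, and a field has no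
  -- nilpotents.
  T≈2⇒T-suc≈ : ∀ m x → T m x ≈ 2# → T (suc m) x ≈ x
  T≈2⇒T-suc≈ m x eq = x-y≈0⇒x≈y (square≈0⇒≈0
    (trans (sym (T-product x m)) (trans (*-congˡ (x≈y⇒x-y≈0 eq)) (zeroʳ _))))

  chebyshevs : PowerLike commutativeRing
  chebyshevs = record
    { g              = T
    ; neutral        = 2#
    ; g-cong         = T-cong
    ; g-∘            = T-∘
    ; g-1            = λ _ → refl
    ; g-neutral      = T-2
    ; g-return       = T≈2⇒T-suc≈
    ; g-isPolynomial = T-isPolynomial
    }

  open PeriodicPoints K chebyshevs qp (chebyshev q) (eval-chebyshev q)

  T-order : ∀ x → T (p ℕ.^ n) x ≈ x
  T-order x = trans (T-frobenius-^ pp (characteristic p n ≡.refl) n x) (^order≈id x)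

  torsion-cover : ∀ {k′} → suc k′ ≡ p ℕ.^ n → ∀ x → Torsion k′ x ⊎ Torsion (suc (suc k′)) x
  torsion-cover {k′} eq x = Sum.swap (Sum.map x-y≈0⇒x≈y x-y≈0⇒x≈y (*-integral (trans (T-product x k′)
    (trans (*-congʳ (x≈y⇒x-y≈0 (trans (reflexive (≡.cong (λ m → T m x) eq)) (T-order x)))) (zeroˡ _)))))

  square≈4 : ∀ x → x * x - 2# * 2# ≈ 0# → x ≈ 2# ⊎ x ≈ - 2#
  square≈4 x eq = Sum.map x-y≈0⇒x≈y (λ eq → x-y≈0⇒x≈y (trans
      (solve 1 (λ x → x :- (:- con (+ 2)) := x :+ con (+ 2)) refl x) eq))
    (*-integral (trans (solve 1 (λ x → (x :- con (+ 2)) :* (x :+ con (+ 2))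
      := x :* x :- con (+ 2) :* con (+ 2)) refl x) eq))

  -- Since T_Q(x) = x, the recurrence reads T_{Q+1}(x) = x² - T_{Q-1}(x); with both values equal to
  -- 2 this is x² = 4.
  torsion-overlap : ∀ {k′} → suc k′ ≡ p ℕ.^ n → ∀ x → Torsion k′ x → Torsion (suc (suc k′)) x →
    x ≈ 2# ⊎ x ≈ - 2#
  torsion-overlap {k′} eq x tors tors′ = square≈4 x (begin
    x * x - 2# * 2#             ≈⟨ solve 1 (λ x → x :* x :- con (+ 2) :* con (+ 2)
                                      := (x :* x :- con (+ 2)) :- con (+ 2)) refl x ⟩
    (x * x - 2#) - 2#           ≈⟨ +-congʳ (+-cong (*-congˡ T-suc) (-‿cong tors)) ⟨
    (x * T (suc k′) x - T k′ x) - 2#  ≈⟨ x≈y⇒x-y≈0 tors′ ⟩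
    0#                          ∎)
    where
    T-suc : T (suc k′) x ≈ x
    T-suc = trans (reflexive (≡.cong (λ m → T m x) eq)) (T-order x)

  -- Starting at 1 instead of 2, these sequences are monic at index 0 as well.
  half-isPolynomial : ∀ {v} → IsPolynomial 1# 1 v → ∀ k → IsPolynomial 1# k (λ x → lucas 1# (v x) x k)
  half-isPolynomial vp zero    _ = refl
  half-isPolynomial vp (suc k)   = lucas-isPolynomial 1# vp k

  #-±2 : # (λ x → (x ≟ 2#) ⊎-dec (x ≟ - 2#)) ℕ.≤ 2
  #-±2 = ℕ.≤-trans
    (FilterLength.length-filter-∪ (λ x → (x ≟ 2#) ⊎-dec (x ≟ - 2#)) (_≟ 2#) (_≟ - 2#) (λ _ → id) elements)
    (ℕ.+-mono-≤ (#-singleton 2#) (#-singleton (- 2#)))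

  -- T_m − 2 is x − 2 or x² − 4 times a square, so it has only about m / 2 roots.
  2*#-torsion : ∀ m → 0 ℕ.< m → 2 ℕ.* # torsion? m ℕ.≤ m ℕ.+ 2
  2*#-torsion m 0<m with parity m
  ... | zero , inj₁ eq = contradiction eq (ℕ.>⇒≢ 0<m)
  ... | suc k , inj₁ ≡.refl = ℕ.≤-trans (ℕ.*-monoʳ-≤ 2 (ℕ.≤-trans
          (FilterLength.length-filter-∪ (torsion? (suc k ℕ.+ suc k)) (λ x → (x ≟ 2#) ⊎-dec (x ≟ - 2#)) (λ x → u x ≟ 0#)
            (λ x tors → Sum.map (square≈4 x) square≈0⇒≈0
              (*-integral (trans (sym (T-even k x)) (x≈y⇒x-y≈0 tors)))) elements)
          (ℕ.+-mono-≤ #-±2 (#-roots k (half-isPolynomial id-isPolynomial k) (λ x → u x ≟ 0#) (λ _ → id)))))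
        (ℕ.≤-reflexive (arithmetic k))
    where
    u : Carrier → Carrier
    u x = lucas 1# x x k
    open import Data.Nat.Tactic.RingSolver using (solve-∀)
    arithmetic : ∀ k → 2 ℕ.* (2 ℕ.+ k) ≡ suc k ℕ.+ suc k ℕ.+ 2
    arithmetic = solve-∀
  ... | k , inj₂ ≡.refl = ℕ.≤-trans (ℕ.*-monoʳ-≤ 2 (ℕ.≤-trans
          (FilterLength.length-filter-∪ (torsion? (suc (k ℕ.+ k))) (_≟ 2#) (λ x → u x ≟ 0#)
            (λ x tors → Sum.map x-y≈0⇒x≈y square≈0⇒≈0
              (*-integral (trans (sym (T-odd k x)) (x≈y⇒x-y≈0 tors)))) elements)
          (ℕ.+-mono-≤ (#-singleton 2#)
            (#-roots k (half-isPolynomial (linear-isPolynomial 1#) k) (λ x → u x ≟ 0#) (λ _ → id)))))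
        (ℕ.≤-trans (ℕ.n≤1+n _) (ℕ.≤-reflexive (arithmetic k)))
    where
    u : Carrier → Carrier
    u x = lucas 1# (x + 1#) x k
    open import Data.Nat.Tactic.RingSolver using (solve-∀)
    arithmetic : ∀ k → suc (2 ℕ.* (1 ℕ.+ k)) ≡ suc (k ℕ.+ k) ℕ.+ 2
    arithmetic = solve-∀

  Bounds : ℕ → Set
  Bounds e = let open Periodic K (chebyshev q) in
    #Per ℕ.* (2 ℕ.* q ℕ.^ e) ℕ.≤ (q ℕ.^ e ℕ.+ 1) ℕ.* p ℕ.^ n ℕ.+ 10 ℕ.* q ℕ.^ e ×
    (q ℕ.^ e ℕ.+ 1) ℕ.* p ℕ.^ n ℕ.≤ #Per ℕ.* (2 ℕ.* q ℕ.^ e) ℕ.+ 10 ℕ.* q ℕ.^ e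

  module _ e {m n′} (q∤m : q ∤ m) (q∤n′ : q ∤ n′)
    (cover : ∀ x → Torsion n′ x ⊎ Torsion (q ℕ.^ e ℕ.* m) x)
    (meet : ∀ x → Torsion n′ x → Torsion (q ℕ.^ e ℕ.* m) x → x ≈ 2# ⊎ x ≈ - 2#)
    (sum≡ : q ℕ.^ e ℕ.* m ℕ.+ n′ ≡ p ℕ.^ n ℕ.+ p ℕ.^ n)
    (N≤ : q ℕ.^ e ℕ.* m ℕ.≤ p ℕ.^ n ℕ.+ 1) (n′≤ : n′ ℕ.≤ p ℕ.^ n ℕ.+ 1) where

    private
      N = q ℕ.^ e ℕ.* m

      instance
        E≢0 : ℕ.NonZero (q ℕ.^ e)
        E≢0 = ℕ.m^n≢0 q e {{prime⇒nonZero qp}}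

    #Per-bounds : Bounds e
    #Per-bounds = ChebyshevCount.count-bounds {n = m} {b = # torsion? N}
      (ℕ.>-nonZero⁻¹ (q ℕ.^ e)) sum≡ N≤ n′≤
      (2*#-torsion n′ (∤⇒>0 q∤n′))
      (2*#-torsion N (ℕ.*-mono-≤ (ℕ.>-nonZero⁻¹ (q ℕ.^ e)) (∤⇒>0 q∤m)))
      (2*#-torsion m (∤⇒>0 q∤m))
      (#-torsion-fibres e m)
      (ℕ.≤-trans (ℕ.≤-reflexive (≡.sym length-elements))
        (FilterLength.length-cover (torsion? n′) (torsion? N) cover elements))
      (FilterLength.length-filter-∪ per? (torsion? n′) (torsion? m)
        (λ x px → Sum.map id (per⇒torsion e m x px) (cover x)) elements)
      (ℕ.≤-trans (FilterLength.length-filter-∩ per? (torsion? n′) (torsion? m) (λ x → (x ≟ 2#) ⊎-dec (x ≟ - 2#))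
          (torsion⇒per q∤n′) (torsion⇒per q∤m)
          -- A_m lies in A_N, so the overlap with A_m is already confined to ±2.
          (λ x t t′ → meet x t (≡.subst (λ j → Torsion j x) (ℕ.*-comm m (q ℕ.^ e)) (torsion-* m (q ℕ.^ e) x t′)))
          elements)
        (ℕ.+-monoʳ-≤ (# per?) #-±2))

  -- Q² - 1 = (Q - 1)(Q + 1) carries the power q^e. The factors differ by 2 and q is odd, so one of
  -- them is prime to q and serves as n′, while the other is q^e times a number prime to q.
  #Per-chebyshev : ∀ e m → 2 ∤ q → q ∤ m → p ℕ.^ (2 ℕ.* n) ≡ 1 ℕ.+ q ℕ.^ e ℕ.* m → Bounds e
  #Per-chebyshev e m 2∤q q∤m p^2n≡ = go (ℕ.pred Q) (ℕ.suc-pred Q)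
    where
    open import Data.Nat.Divisibility using (_∣?_; ∣m+n∣m⇒∣n)
    open import Data.Nat.Tactic.RingSolver using (solve-∀)
    open Arithmetic using (exact-cofactor; odd-prime∤2)
    Q = p ℕ.^ n
    instance
      Q≢0 : ℕ.NonZero Q
      Q≢0 = ℕ.m^n≢0 p n {{prime⇒nonZero pp}}
    product : ∀ Q′ → suc Q′ ≡ Q → Q′ ℕ.* (2 ℕ.+ Q′) ≡ q ℕ.^ e ℕ.* m
    product Q′ eq = ℕ.suc-injective (≡.trans (factored Q′) (≡.trans (≡.cong (λ z → z ℕ.* (z ℕ.* 1)) eq)
      (≡.trans (ℕ.^-*-assoc p n 2) (≡.trans (≡.cong (p ℕ.^_) (ℕ.*-comm n 2)) p^2n≡))))
      where
      factored : ∀ r → suc (r ℕ.* (2 ℕ.+ r)) ≡ suc r ℕ.* (suc r ℕ.* 1)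
      factored = solve-∀
    sum : ∀ r → r ℕ.+ (2 ℕ.+ r) ≡ suc r ℕ.+ suc r
    sum = solve-∀
    sum′ : ∀ r → (2 ℕ.+ r) ℕ.+ r ≡ suc r ℕ.+ suc r
    sum′ = solve-∀
    q∤2+Q′ : ∀ {r} → q ∣ r → q ∤ 2 ℕ.+ r
    q∤2+Q′ {r} q∣r q∣2+r = odd-prime∤2 qp 2∤q (∣m+n∣m⇒∣n (≡.subst (q ∣_) (ℕ.+-comm 2 r) q∣2+r) q∣r)
    go : ∀ Q′ → suc Q′ ≡ Q → Bounds e
    go Q′ eq with q ∣? Q′
    ... | no q∤Q′ with c , 2+Q′≡ , q∤c ← exact-cofactor qp e {Q′} {2 ℕ.+ Q′} q∤Q′ (product Q′ eq) q∤m =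
      #Per-bounds e q∤c q∤Q′
        (λ x → Sum.map id (≡.subst (λ j → Torsion j x) 2+Q′≡) (torsion-cover eq x))
        (λ x t t′ → torsion-overlap eq x t (≡.subst (λ j → Torsion j x) (≡.sym 2+Q′≡) t′))
        (≡.subst (λ j → j ℕ.+ Q′ ≡ Q ℕ.+ Q) 2+Q′≡ (≡.trans (sum′ Q′) (≡.cong₂ ℕ._+_ eq eq)))
        (≡.subst (ℕ._≤ Q ℕ.+ 1) 2+Q′≡ (ℕ.≤-reflexive (≡.trans (≡.cong suc eq) (ℕ.+-comm 1 Q))))
        (ℕ.≤-trans (ℕ.≤-trans (ℕ.n≤1+n Q′) (ℕ.≤-reflexive eq)) (ℕ.m≤m+n Q 1))
    ... | yes q∣Q′ with c , ≡.refl , q∤c ← exact-cofactor qp e {2 ℕ.+ Q′} {Q′}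
                          (q∤2+Q′ q∣Q′) (≡.trans (ℕ.*-comm (2 ℕ.+ Q′) Q′) (product Q′ eq)) q∤m =
      #Per-bounds e q∤c (q∤2+Q′ q∣Q′)
        (λ x → Sum.swap (torsion-cover eq x))
        (λ x t t′ → torsion-overlap eq x t′ t)
        (≡.trans (sum Q′) (≡.cong₂ ℕ._+_ eq eq))
        (ℕ.≤-trans (ℕ.≤-trans (ℕ.n≤1+n Q′) (ℕ.≤-reflexive eq)) (ℕ.m≤m+n Q 1))
        (ℕ.≤-reflexive (≡.trans (≡.cong suc eq) (ℕ.+-comm 1 Q)))

-- The two limits.

open import Data.Nat.Base using (_+_; _*_; _∸_; _^_; NonZero)
open import Data.Nat.Properties using (m*n≢0)
open import Data.Integer.Base using (+_)
open import Data.Rational.Base using (_/_)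
open Periodic using (#Per)

mainTheorem1 : ∀ {c ℓ₁ ℓ₂ : Level} (p q : ℕ) (pp : Prime p) (qp : Prime q) →
    2 ∤ q → q ≢ p →
    (δ μ : ℕ) → IsMultOrder q p δ → IsValuation q (p ^ δ ∸ 1) μ →
    (F : ∀ n → .{{NonZero n}} → FiniteField c ℓ₁ ℓ₂ (p ^ n)) →
    (ν : ℕ) →
    LimitAlong (λ n → δ ∣ n × IsValuation q n ν)
    (λ n → _/_ (+ #Per (F n) (power q)) (p ^ n) {{prime^≢0 pp n}})
    (_/_ (+ 1) (q ^ (μ + ν)) {{prime^≢0 qp (μ + ν)}})
    ×
    LimitAlong (λ n → δ ∣ 2 * n × IsValuation q n ν)
    (λ n → _/_ (+ #Per (F n) (chebyshev q)) (p ^ n) {{prime^≢0 pp n}})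
    (_/_ (+ (q ^ (μ + ν) + 1)) (2 * q ^ (μ + ν))
    {{m*n≢0 2 (q ^ (μ + ν)) {{_}} {{prime^≢0 qp (μ + ν)}}}})
mainTheorem1 p q pp qp 2∤q q≢p δ μ ord val F ν =
  limitAlong-of-bounded-error pp (λ n → #Per (F n) (power q)) 1 E {{E≢0}} E unbounded
    (λ n (δ∣n , val-n) → let m , q∤m , p^n≡ = p^n-valuation δ∣n val-n in
      PowerMap.#Per-power (F n) qp (μ + ν) m q∤m (≡.sym p^n≡)) ,
  limitAlong-of-bounded-error pp (λ n → #Per (F n) (chebyshev q)) (E + 1) (2 * E)
    {{m*n≢0 2 E {{_}} {{E≢0}}}} (10 * E)
    -- Multiples of δ already give arbitrarily large n with δ ∣ 2n.
    (λ N → let n , N≤n , n≢0 , δ∣n , val-n = unbounded N in n , N≤n , n≢0 , ∣n⇒∣m*n 2 δ∣n , val-n)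
    (λ n (δ∣2n , val-n) →
      -- The valuation formula is used at 2n; as q is odd, v_q(2n) = v_q(n), so the exponent is
      -- again μ + ν.
      let m , q∤m , p^2n≡ = p^n-valuation δ∣2n (*-∤-valuation qp {ν = ν} (odd-prime∤2 qp 2∤q) val-n) in
      ChebyshevMap.#Per-chebyshev {n = n} pp (F n) qp (μ + ν) m 2∤q q∤m p^2n≡)
  where
  open Arithmetic
  open Limits
  E = q ^ (μ + ν)
  E≢0 : NonZero E
  E≢0 = prime^≢0 qp (μ + ν)
  unbounded : ∀ N → ∃[ n ] N ℕ.≤ n × NonZero n × (δ ∣ n × IsValuation q n ν)
  unbounded = ∣∧valuation-unbounded qp (IsMultOrder.positive ord) (∤-multOrder pp qp q≢p ord) ν
  p^n-valuation : ∀ {n} → δ ∣ n → IsValuation q n ν → ∃[ m ] q ∤ m × p ^ n ≡ 1 + q ^ (μ + ν) * m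
  p^n-valuation = valuation-of-p^n∸1 {μ = μ} pp qp 2∤q q≢p ord val
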